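{- Let $\tau_1,\tau_2$ be vocabularies, let $\ell\ge1$, let $$\Theta=\bigl(\theta_V(\bar u),\ \theta_\approx(\bar u,\bar v),\ (\theta_R(\bar u_{R,1},\dots,\bar u_{R,\mathrm{ar}(R)}))_{R\in\tau_2}\bigr)$$ be an $\ell$-ary $\mathsf{LREC}_=[\tau_1,\tau_2]$-transduction, and let $\varphi(x_1,\dots,x_\kappa,p_1,\dots,p_\lambda)$ be an $\mathsf{LREC}_=[\tau_2]$-formula with $x_1,\dots,x_\kappa$ structure variables and $p_1,\dots,p_\lambda$ number variables. Then there is an $\mathsf{LREC}_=[\tau_1]$-formula $\varphi^{ -\Theta}(\bar u_1,\dots,\bar u_\kappa,\bar q_1,\dots,\bar q_\lambda)$, where $\bar u_1,\dots,\bar u_\kappa$ are compatible with $\bar u$ and $\bar q_1,\dots,\bar q_\lambda$ are $\ell$-tuples of number variables, such that for all $\tau_1$-structures $A$ where $\Theta[A]$ is defined, all $\bar a_1,\dots,\bar a_\kappa\in A^{\bar u}$ and all $\bar n_1,\dots,\bar n_\lambda\in N(A)^\ell$: $A\models\varphi^{ -\Theta}[\bar a_1,\dots,\bar a_\kappa,\bar n_1,\dots,\bar n_\lambda]$ if and only if $\bar a_1/_\approx,\dots,\bar a_\kappa/_\approx\in V(\Theta[A])$, and $\langle\bar n_1\rangle_A,\dots,\langle\bar n_\lambda\rangle_A\in N(\Theta[A])$, and $\Theta[A]\models\varphi\bigl[\bar a_1/_\approx,\dots,\bar a_\kappa/_\approx,\langle\bar n_1\rangle_A,\dots,\langle\bar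 n_\lambda\rangle_A\bigr]$, where $\approx$ is the equivalence relation generated by $\theta_\approx[A;\bar u,\bar v]$.
   Context: Transductions. Let $\mathsf L$ be a logic. An $\ell$-ary $\mathsf L[\tau_1,\tau_2]$-transduction is a tuple $\Theta=(\theta_V(\bar u),\theta_\approx(\bar u,\bar v),(\theta_R(\bar u_{R,1},\dots,\bar u_{R,\mathrm{ar}(R)}))_{R\in\tau_2})$ of $\mathsf L[\tau_1]$-formulae, where $\bar u,\bar v$ are compatible $\ell$-tuples of variables and every $\bar u_{R,i}$ is an $\ell$-tuple of variables compatible with $\bar u$. For a $\tau_1$-structure $A$ such that $\theta_V[A;\bar u]$ is non-empty (exactly then $\Theta[A]$ is defined), let $\approx$ be the reflexive, symmetric, transitive closure of $\theta_\approx[A;\bar u,\bar v]$ (the equivalence relation generated by it, on $A^{\bar u}$). The $\tau_2$-structure $\Theta[A]$ has universe $V(\Theta[A])=\theta_V[A;\bar u]/_\approx=\{\bar a/_\approx:\bar a\in\theta_V[A;\bar u]\}$ and relations $R(\Theta[A])=\{(\bar a_1/_\approx,\dots,\bar a_{\mathrm{ar}(R)}/_\approx):\bar a_1,\dots,\bar a_{\mathrm{ar}(R)}\in\theta_V[A;\bar u],\ A\models\theta_R[\bar a_1,\dots,\bar a_{\mathrm{ar}(R)}]\}$. Basic conventions. $[m,n]=\{p\in\mathbb{N}: m\le p\le n\}$. A vocabulary $\tau$ is a finite set of relation symbols $R$ with arities $\mathrm{ar}(R)$. A $\tau$-structure $A$ has a non-empty finite universe $V(A)$ and relations $R(A)\subseteq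 V(A)^{\mathrm{ar}(R)}$. Every structure $A$ is equipped with a number sort $N(A)=[0,|V(A)|]$. Variables are either structure variables (ranging over $V(A)$) or number variables (ranging over $N(A)$); $A^u$ is $V(A)$ or $N(A)$ accordingly, and $A^{(u_1,\dots,u_k)}=A^{u_1}\times\dots\times A^{u_k}$. Two tuples of variables are compatible if they have the same length and the same types position by position. For a tuple $\bar u$, $\tilde u$ is the set of its entries. An assignment $\alpha$ in $A$ maps each variable $u$ to an element of $A^u$; $\alpha[\bar a/\bar u]$ is $\alpha$ modified to map $\bar u$ to $\bar a$. For $\bar n=(n_1,\dots,n_k)\in N(A)^k$ let $\langle\bar n\rangle=\langle\bar n\rangle_A=\sum_{i=1}^k n_i(|V(A)|+1)^{i-1}$. The logic $\mathsf{FO{+}C}[\tau]$ extends (two-sorted) first-order logic over $\tau$ by formulae $p\le q$ for number variables $p,q$, and $\#\bar u\,\psi=\bar p$ for a tuple $\bar u$ of variables, a tuple $\bar p$ of number variables and a formula $\psi$; the latter holds in $(A,\alpha)$ iff $|\{\bar a\in A^{\bar u}:(A,\alpha[\bar a/\bar u])\models\psi\}|=\langle\alpha(\bar p)\rangle_A$. Write $\varphi[A,\alpha;\bar u]=\{\bar a\in A^{\bar u}:(A,\alpha[\bar a/\bar u])\models\varphi\}$, and omit $\alpha$ when all free variables are among $\bar u$. The logic $\mathsf{LREC}_=$. $\mathsf{LREC}_=[\tau]$ is obtained by adding to the formation rules of $\mathsf{FO{+}C}[\tau]$ the rule: if $\bar u,\bar v,\bar w$ are compatible tuples of variables, $\bar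 p,\bar r$ are non-empty tuples of number variables, and $\varphi_=,\varphi_E,\varphi_C$ are $\mathsf{LREC}_=[\tau]$-formulae, then $\varphi=[\mathrm{lrec}_{\bar u,\bar v,\bar p}\;\varphi_=,\varphi_E,\varphi_C](\bar w,\bar r)$ is an $\mathsf{LREC}_=[\tau]$-formula, with free variables $(\mathrm{free}(\varphi_=)\setminus(\tilde u\cup\tilde v))\cup(\mathrm{free}(\varphi_E)\setminus(\tilde u\cup\tilde v))\cup(\mathrm{free}(\varphi_C)\setminus(\tilde u\cup\tilde p))\cup\tilde w\cup\tilde r$. Semantics: given $(A,\alpha)$, let $\mathtt V_0=A^{\bar u}$, $\mathtt E_0=\varphi_E[A,\alpha;\bar u,\bar v]$, and let $\sim$ be the reflexive, symmetric, transitive closure of $\varphi_=[A,\alpha;\bar u,\bar v]$ on $\mathtt V_0$. Let $\mathtt V=\mathtt V_0/_\sim$, $\mathtt E=\{(\bar a/_\sim,\bar b/_\sim):\bar a\bar b\in\mathtt E_0\}$, and $\mathtt C(\bar a/_\sim)=\{\langle\bar n\rangle:\bar n\in\varphi_C[A,\alpha[\bar a'/\bar u];\bar p]\text{ for some }\bar a'\in\bar a/_\sim\}$. For $c\in\mathtt V$ let $c\mathtt E$ and $\mathtt Ec$ be the sets of out-neighbours and in-neighbours of $c$ in $(\mathtt V,\mathtt E)$. Define $X\subseteq\mathtt V\times\mathbb N$ recursively by: $(c,\ell)\in X$ iff $\ell>0$ and $\bigl|\{d\in c\mathtt E:(d,\lfloor(\ell-1)/|\mathtt Ed|\rfloor)\in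 X\}\bigr|\in\mathtt C(c)$. Then $(A,\alpha)\models\varphi$ iff $(\alpha(\bar w)/_\sim,\langle\alpha(\bar r)\rangle)\in X$. -}

module Defs where

open import Data.Bool using (Bool; true; false; T; T?; not; _∧_; _∨_)
open import Data.Bool.ListAction using (any; all)
open import Data.Digit using (fromDigits)
open import Data.Fin using (Fin; toℕ)
import Data.Fin.Properties as Fin
open import Data.List using (List; []; _∷_; [_]; _++_; length; replicate; concat; map; allFin;
  filterᵇ; cartesianProduct; cartesianProductWith; deduplicate; lookup)
open import Data.List.Membership.Propositional using (_∈_)
open import Data.List.Membership.Propositional.Properties using (∈-allFin; ∈-map⁺; ∈-filter⁺;
  ∈-filter⁻; ∈-cartesianProduct⁺; ∈-cartesianProductWith⁺)
open import Data.List.Properties using (filter-≐)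
open import Data.List.Relation.Unary.All as All using (All; []; _∷_)
open import Data.List.Relation.Unary.All.Properties using (++⁺)
open import Data.List.Relation.Unary.Any using (here; there)
open import Data.Nat using (ℕ; zero; suc; _<_; _≡ᵇ_; _≤ᵇ_; _/_; NonZero; z≤n; s≤s)
open import Data.Nat.DivMod using (m/n≤m)
open import Data.Nat.Induction using (Acc; acc; <-wellFounded)
open import Data.Product using (_×_; _,_; proj₂; uncurry; ∃-syntax)
open import Data.Sum using (_⊎_; inj₁; inj₂)
open import Data.Vec as Vec using (Vec; []; _∷_)
open import Data.Vec.Relation.Binary.Pointwise.Inductive as Pointwise using (Pointwise)
open import Function using (_∘_; _↔_; Inverse)
open import Function.Properties.Inverse using (↔-refl; ↔⇒↣)
open import Relation.Binary using (Rel; DecidableEquality; Decidable)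
open import Relation.Binary.Construct.Closure.Equivalence as Eq using (EqClosure)
open import Relation.Binary.Construct.Closure.ReflexiveTransitive using (ε; _◅_; _◅◅_)
open import Relation.Binary.Construct.Closure.Symmetric using (fwd; bwd)
open import Relation.Binary.PropositionalEquality using (_≡_; refl; sym; cong; subst)
open import Relation.Nullary using (Dec; yes; no; ⌊_⌋)
open import Relation.Nullary.Decidable using (map′; _⊎-dec_; _×-dec_)

------------------------------------------------------------------------
-- Generated equivalence relations on finite sets

module _ {X : Set} (_≟_ : DecidableEquality X) where

  private
    ListRel : List (X × X) → Rel X _
    ListRel es x y = (x , y) ∈ es

    Via : X → X → List (X × X) → Rel X _
    Via a b es x y = EqClosure (ListRel es) x y
      ⊎ (EqClosure (ListRel es) x a × EqClosure (ListRel es) b y)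
      ⊎ (EqClosure (ListRel es) x b × EqClosure (ListRel es) a y)

    via⁺ : ∀ {a b es x y} → Via a b es x y → EqClosure (ListRel ((a , b) ∷ es)) x y
    via⁺ (inj₁ p)              = Eq.map there p
    via⁺ (inj₂ (inj₁ (p , q))) = Eq.map there p ◅◅ fwd (here refl) ◅ Eq.map there q
    via⁺ (inj₂ (inj₂ (p , q))) = Eq.map there p ◅◅ bwd (here refl) ◅ Eq.map there q

    via⁻ : ∀ {a b es x y} → EqClosure (ListRel ((a , b) ∷ es)) x y → Via a b es x y
    via⁻ ε = inj₁ ε
    via⁻ (fwd (here refl) ◅ p) with via⁻ p
    ... | inj₁ q              = inj₂ (inj₁ (ε , q))
    ... | inj₂ (inj₁ (q , r)) = inj₂ (inj₁ (ε , r))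
    ... | inj₂ (inj₂ (q , r)) = inj₁ r
    via⁻ (bwd (here refl) ◅ p) with via⁻ p
    ... | inj₁ q              = inj₂ (inj₂ (ε , q))
    ... | inj₂ (inj₁ (q , r)) = inj₁ r
    ... | inj₂ (inj₂ (q , r)) = inj₂ (inj₂ (ε , r))
    via⁻ (fwd (there e) ◅ p) with via⁻ p
    ... | inj₁ q              = inj₁ (fwd e ◅ q)
    ... | inj₂ (inj₁ (q , r)) = inj₂ (inj₁ (fwd e ◅ q , r))
    ... | inj₂ (inj₂ (q , r)) = inj₂ (inj₂ (fwd e ◅ q , r))
    via⁻ (bwd (there e) ◅ p) with via⁻ p
    ... | inj₁ q              = inj₁ (bwd e ◅ q)
    ... | inj₂ (inj₁ (q , r)) = inj₂ (inj₁ (bwd e ◅ q , r))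
    ... | inj₂ (inj₂ (q , r)) = inj₂ (inj₂ (bwd e ◅ q , r))

    listClosure? : ∀ es → Decidable (EqClosure (ListRel es))
    listClosure? [] x y =
      map′ (λ { refl → ε }) (λ { ε → refl ; (fwd () ◅ _) ; (bwd () ◅ _) }) (x ≟ y)
    listClosure? ((a , b) ∷ es) x y = map′ via⁺ via⁻
      (listClosure? es x y
       ⊎-dec ((listClosure? es x a ×-dec listClosure? es b y)
       ⊎-dec (listClosure? es x b ×-dec listClosure? es a y)))

  Generated : (X → X → Bool) → Rel X _
  Generated r = EqClosure (λ x y → T (r x y))

  generated? : (xs : List X) → (∀ x → x ∈ xs) → ∀ r → Decidable (Generated r)
  generated? xs complete r x y =
    map′ (Eq.map (λ e → proj₂ (∈-filter⁻ (T? ∘ uncurry r) {xs = cartesianProduct xs xs} e)))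
         (Eq.map (λ {a} {b} t → ∈-filter⁺ (T? ∘ uncurry r)
           (∈-cartesianProduct⁺ (complete a) (complete b)) t))
         (listClosure? (filterᵇ (uncurry r) (cartesianProduct xs xs)) x y)

------------------------------------------------------------------------
-- Structures

record Vocabulary : Set where
  field
    symbols : ℕ
    ar      : Fin symbols → ℕ

open Vocabulary public

-- Relations are Bool-valued, so that finite structures are decidable objects.
record Structure (τ : Vocabulary) : Set₁ where
  field
    V            : Set
    size         : ℕ
    {{nonEmpty}} : NonZero size
    finite       : V ↔ Fin size
    interp       : (R : Fin (symbols τ)) → Vec V (ar τ R) → Bool

open Structure public

data Sort : Set where
  str num : Sort

-- A typed tuple of variables is represented by the list of its sorts; two
-- tuples are compatible when these lists are equal.  The same lists serve as
-- contexts of free variables, and a variable is a position in a context.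
Ctx : Set
Ctx = List Sort

nums : ℕ → Ctx
nums k = replicate k num

-- A^u for a single variable u.  The number sort N(A) = [0,|V(A)|].
Dom : ∀ {τ} → Structure τ → Sort → Set
Dom A str = V A
Dom A num = Fin (suc (size A))

-- A^ū for ū of type ts; also the assignments for a context.
_^_ : ∀ {τ} → Structure τ → Ctx → Set
A ^ ts = All (Dom A) ts

module _ {τ : Vocabulary} (A : Structure τ) where

  elements : ∀ s → List (Dom A s)
  elements str = map (Inverse.from (finite A)) (allFin (size A))
  elements num = allFin (suc (size A))

  -- Lists every element of A ^ ts exactly once.
  tuples : ∀ ts → List (A ^ ts)
  tuples []       = [ [] ]
  tuples (t ∷ ts) = cartesianProductWith _∷_ (elements t) (tuples ts)

  elements-complete : ∀ s (x : Dom A s) → x ∈ elements s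
  elements-complete str x =
    subst (_∈ elements str) (Inverse.strictlyInverseʳ (finite A) x)
      (∈-map⁺ (Inverse.from (finite A)) (∈-allFin (Inverse.to (finite A) x)))
  elements-complete num x = ∈-allFin x

  tuples-complete : ∀ {ts} (a : A ^ ts) → a ∈ tuples ts
  tuples-complete {[]}     []      = here refl
  tuples-complete {t ∷ ts} (x ∷ a) =
    ∈-cartesianProductWith⁺ _∷_ (elements-complete t x) (tuples-complete a)

  dom-≟ : ∀ s → DecidableEquality (Dom A s)
  dom-≟ str = Fin.inj⇒≟ (↔⇒↣ (finite A))
  dom-≟ num = Fin._≟_

  _≟ᵗ_ : ∀ {ts} → DecidableEquality (A ^ ts)
  _≟ᵗ_ {[]}     []      []      = yes refl
  _≟ᵗ_ {t ∷ ts} (x ∷ a) (y ∷ b) = map′ (λ { (refl , refl) → refl }) (λ { refl → refl , refl })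
                            (dom-≟ t x y ×-dec (a ≟ᵗ b))

  -- The equivalence relation on A ^ ts generated by r.
  Gen : ∀ {ts} → (A ^ ts → A ^ ts → Bool) → Rel (A ^ ts) _
  Gen = Generated _≟ᵗ_

  gen? : ∀ {ts} (r : A ^ ts → A ^ ts → Bool) → Decidable (Gen r)
  gen? {ts} = generated? _≟ᵗ_ (tuples ts) tuples-complete

  digits : ∀ k → A ^ nums k → List (Fin (suc (size A)))
  digits zero    []       = []
  digits (suc k) (n ∷ ns) = n ∷ digits k ns

  -- ⟨n̄⟩ in base |V(A)|+1, least significant digit first.
  value : ∀ k → A ^ nums k → ℕ
  value k ns = fromDigits (digits k ns)

------------------------------------------------------------------------
-- Formulae

infix  9 ¬′_
infixr 6 _∧′_
infixr 5 _∨′_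

data Formula (τ : Vocabulary) (Γ : Ctx) : Set where
  equal : ∀ {s} → s ∈ Γ → s ∈ Γ → Formula τ Γ
  rel   : (R : Fin (symbols τ)) → Vec (str ∈ Γ) (ar τ R) → Formula τ Γ
  leq   : num ∈ Γ → num ∈ Γ → Formula τ Γ
  ¬′_   : Formula τ Γ → Formula τ Γ
  _∧′_  : Formula τ Γ → Formula τ Γ → Formula τ Γ
  _∨′_  : Formula τ Γ → Formula τ Γ → Formula τ Γ
  ∃′    : ∀ s → Formula τ (s ∷ Γ) → Formula τ Γ
  ∀′    : ∀ s → Formula τ (s ∷ Γ) → Formula τ Γ
  -- # ū ψ = p̄
  count : ∀ ts {k} (ψ : Formula τ (ts ++ Γ)) (p : All (_∈ Γ) (nums k)) → Formula τ Γ
  -- [lrec_{ū,v̄,p̄} φ₌, φE, φC](w̄, r̄)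
  lrec  : ∀ ts {k j}
          (φ₌ φE : Formula τ (ts ++ ts ++ Γ))
          (φC : Formula τ (ts ++ nums (suc k) ++ Γ))
          (w : All (_∈ Γ) ts) (r : All (_∈ Γ) (nums (suc j))) → Formula τ Γ

------------------------------------------------------------------------
-- Semantics of the recursion operator

infixl 7 _÷_

-- Total version of ⌊m/n⌋; below, n is always the in-degree of a vertex that
-- has an in-neighbour, so the value for n = 0 is immaterial.
_÷_ : ℕ → ℕ → ℕ
m ÷ zero  = 0
m ÷ suc n = m / suc n

÷-< : ∀ m n → m ÷ n < suc m
÷-< m zero    = s≤s z≤n
÷-< m (suc n) = s≤s (m/n≤m m (suc n))

module LRec {τ : Vocabulary} (A : Structure τ) (ts : Ctx) {k : ℕ}
            (r₌ rE : A ^ ts → A ^ ts → Bool) (rC : A ^ ts → A ^ nums k → Bool) where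

  -- Vertices a/∼ are handled through arbitrary representatives a ∈ A ^ ts.
  _∼_ : Rel (A ^ ts) _
  _∼_ = Gen A r₌

  _∼?_ : Decidable _∼_
  _∼?_ = gen? A r₌

  edge : A ^ ts → A ^ ts → Bool
  edge a b = any (λ a′ → any (λ b′ → ⌊ a ∼? a′ ⌋ ∧ ⌊ b ∼? b′ ⌋ ∧ rE a′ b′)
                             (tuples A ts)) (tuples A ts)

  label : A ^ ts → ℕ → Bool
  label a m = any (λ a′ → any (λ n → ⌊ a ∼? a′ ⌋ ∧ rC a′ n ∧ (value A k n ≡ᵇ m))
                              (tuples A (nums k))) (tuples A ts)

  -- For ∼-invariant P, the number of classes a/∼ with P a: deduplication
  -- keeps one representative of each class.
  classes : (A ^ ts → Bool) → ℕ
  classes P = length (deduplicate _∼?_ (filterᵇ P (tuples A ts)))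

  inDegree : A ^ ts → ℕ
  inDegree d = classes (λ c → edge c d)

  inX-acc : ∀ ℓ → Acc _<_ ℓ → A ^ ts → Bool
  inX-acc zero    _        c = false
  inX-acc (suc ℓ) (acc rs) c = label c (classes λ d →
    edge c d ∧ inX-acc (ℓ ÷ inDegree d) (rs (÷-< ℓ (inDegree d))) d)

  -- (c/∼ , ℓ) ∈ X
  inX : A ^ ts → ℕ → Bool
  inX c ℓ = inX-acc ℓ (<-wellFounded ℓ) c

  classes-cong : ∀ {P Q} → (∀ a → P a ≡ Q a) → classes P ≡ classes Q
  classes-cong {P} {Q} eq = cong (length ∘ deduplicate _∼?_)
    (filter-≐ (T? ∘ P) (T? ∘ Q)
      ((λ {a} → subst T (eq a)) , (λ {a} → subst T (sym (eq a)))) (tuples A ts))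

  inX-irr : ∀ ℓ (p q : Acc _<_ ℓ) c → inX-acc ℓ p c ≡ inX-acc ℓ q c
  inX-irr zero    _        _        c = refl
  inX-irr (suc ℓ) (acc rs) (acc ss) c = cong (label c) (classes-cong λ d →
    cong (edge c d ∧_) (inX-irr (ℓ ÷ inDegree d) (rs _) (ss _) d))

  inX-zero : ∀ c → inX c 0 ≡ false
  inX-zero c = refl

  inX-suc : ∀ c ℓ → inX c (suc ℓ) ≡
            label c (classes λ d → edge c d ∧ inX d (ℓ ÷ inDegree d))
  inX-suc c ℓ = inX-irr (suc ℓ) (<-wellFounded (suc ℓ)) (acc λ {y} _ → <-wellFounded y) c

------------------------------------------------------------------------
-- Satisfaction

infix 5 _⟦_⟧_

_⟦_⟧_ : ∀ {τ Γ} (A : Structure τ) → Formula τ Γ → A ^ Γ → Bool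
A ⟦ equal {s} x y ⟧ α = ⌊ dom-≟ A s (All.lookup α x) (All.lookup α y) ⌋
A ⟦ rel R xs ⟧ α = interp A R (Vec.map (All.lookup α) xs)
A ⟦ leq p q ⟧ α = toℕ (All.lookup α p) ≤ᵇ toℕ (All.lookup α q)
A ⟦ ¬′ φ ⟧ α = not (A ⟦ φ ⟧ α)
A ⟦ φ ∧′ ψ ⟧ α = (A ⟦ φ ⟧ α) ∧ (A ⟦ ψ ⟧ α)
A ⟦ φ ∨′ ψ ⟧ α = (A ⟦ φ ⟧ α) ∨ (A ⟦ ψ ⟧ α)
A ⟦ ∃′ s φ ⟧ α = any (λ a → A ⟦ φ ⟧ (a ∷ α)) (elements A s)
A ⟦ ∀′ s φ ⟧ α = all (λ a → A ⟦ φ ⟧ (a ∷ α)) (elements A s)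
A ⟦ count ts {k} ψ p ⟧ α =
  length (filterᵇ (λ a → A ⟦ ψ ⟧ (++⁺ a α)) (tuples A ts))
    ≡ᵇ value A k (All.map (All.lookup α) p)
A ⟦ lrec ts {k} {j} φ₌ φE φC w r ⟧ α =
  LRec.inX A ts {suc k}
    (λ a b → A ⟦ φ₌ ⟧ (++⁺ a (++⁺ b α)))
    (λ a b → A ⟦ φE ⟧ (++⁺ a (++⁺ b α)))
    (λ a n → A ⟦ φC ⟧ (++⁺ a (++⁺ n α)))
    (All.map (All.lookup α) w) (value A (suc j) (All.map (All.lookup α) r))

infix 4 _⊨_[_]

_⊨_[_] : ∀ {τ Γ} (A : Structure τ) → Formula τ Γ → A ^ Γ → Set
A ⊨ φ [ α ] = T (A ⟦ φ ⟧ α)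

------------------------------------------------------------------------
-- Transductions

-- The type of n pairwise disjoint tuples of type ts.
copies : ℕ → Ctx → Ctx
copies n ts = concat (replicate n ts)

flatten : ∀ {τ} {A : Structure τ} {ts n} → Vec (A ^ ts) n → A ^ copies n ts
flatten []       = []
flatten (a ∷ as) = ++⁺ a (flatten as)

-- Assignment of x₁,…,x_κ,p₁,…,p_lam.
assign : ∀ {τ} {A : Structure τ} {κ lam} →
         Vec (V A) κ → Vec (Fin (suc (size A))) lam → A ^ (replicate κ str ++ nums lam)
assign         (x ∷ xs) ns       = x ∷ assign xs ns
assign         []       (n ∷ ns) = n ∷ assign [] ns
assign         []       []       = []

record Transduction (τ₁ τ₂ : Vocabulary) : Set where
  field
    sorts : Ctx
    θV    : Formula τ₁ sorts
    θ≈    : Formula τ₁ (sorts ++ sorts)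
    θR    : (R : Fin (symbols τ₂)) → Formula τ₁ (copies (ar τ₂ R) sorts)

  arity : ℕ
  arity = length sorts

open Transduction public

vectors : ∀ {X : Set} → List X → ∀ n → List (Vec X n)
vectors xs zero    = [ [] ]
vectors xs (suc n) = cartesianProductWith _∷_ xs (vectors xs n)

module _ {τ₁ τ₂ : Vocabulary} (Θ : Transduction τ₁ τ₂) (A : Structure τ₁) where

  Defined : Set
  Defined = ∃[ a ] A ⊨ θV Θ [ a ]

  _≈Θ_ : Rel (A ^ sorts Θ) _
  _≈Θ_ = Gen A (λ a b → A ⟦ θ≈ Θ ⟧ (++⁺ a b))

  _≈Θ?_ : Decidable _≈Θ_
  _≈Θ?_ = gen? A (λ a b → A ⟦ θ≈ Θ ⟧ (++⁺ a b))

  domain : List (A ^ sorts Θ)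
  domain = filterᵇ (λ a → A ⟦ θV Θ ⟧ a) (tuples A (sorts Θ))

  -- One element of θV[A;ū] from each class a/≈ that meets θV[A;ū].
  representatives : List (A ^ sorts Θ)
  representatives = deduplicate _≈Θ?_ domain

  -- V(Θ[A]), the class with representative lookup representatives i being
  -- identified with its index i.
  Class : Set
  Class = Fin (length representatives)

  -- a /≈≡ i states that a/≈ ∈ V(Θ[A]) and that i is this class.
  _/≈≡_ : A ^ sorts Θ → Class → Set
  a /≈≡ i = a ≈Θ lookup representatives i

  _/≈≡?_ : ∀ a i → Dec (a /≈≡ i)
  a /≈≡? i = a ≈Θ? lookup representatives i

  representatives-nonEmpty : Defined → NonZero (length representatives)
  representatives-nonEmpty (a , p)
    with domain | ∈-filter⁺ (λ b → T? (A ⟦ θV Θ ⟧ b)) (tuples-complete A a) p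
  ... | _ ∷ _ | _ = _

  -- Θ[A]
  transduce : Defined → Structure τ₂
  transduce d = record
    { V        = Class
    ; size     = length representatives
    ; nonEmpty = representatives-nonEmpty d
    ; finite   = ↔-refl
    ; interp   = λ R cs → any
        (λ as → ⌊ Pointwise.decidable _/≈≡?_ as cs ⌋ ∧ (A ⟦ θR Θ R ⟧ flatten as))
        (vectors domain (ar τ₂ R))
    }

{-# OPTIONS --safe #-}
-- Over A, a structure variable of φ becomes a tuple of the sorts of Θ, taken
-- up to ≈, and a number variable becomes the tuple of its digits in base
-- |V(A)|+1.  Equality in Θ[A], that is membership in a generated equivalence
-- relation, is an lrec formula without edges.  The number of classes of a
-- definable set of tuples is the out-degree of the centre of a star, which
-- lrec compares with its label; this bounds the number sort of Θ[A] and
-- interprets #.  The value ⟨p̄⟩ in base |V(Θ[A])|+1 is the number of tuples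
-- below p̄, so that changing the base is again counting.  Finally, lrec is
-- translated to lrec: the set X depends only on the quotient graph, the sets
-- of labels and the budget as a natural number, and none of these changes,
-- apart from isolated vertices for the tuples that represent nothing.
module Submission where

open import Defs
open import Data.Bool using (Bool; true; false; T; T?; not; _∧_; _∨_)
open import Data.Bool.Properties using (T-∧; T-∨)
open import Data.Bool.ListAction using (any; or; and)
open import Data.Empty using (⊥; ⊥-elim)
open import Data.Fin as Fin using (Fin; zero; suc; toℕ)
import Data.Fin.Properties as Fin
open import Data.List using (List; []; _∷_; _++_; length; replicate; map; allFin; filterᵇ;
  cartesianProductWith; deduplicate; lookup)
open import Data.List.Membership.Propositional using (_∈_; find; lose)
open import Data.List.Membership.Propositional.Properties using (∈-filter⁺; ∈-filter⁻; ∈-lookup;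
  ∈-++⁺ʳ; ∈-cartesianProductWith⁺; ∈-cartesianProductWith⁻)
open import Data.List.Properties using (length-++; length-map; length-tabulate; length-filter;
  length-deduplicate; filter-≐)
open import Data.List.Relation.Unary.All as All using (All; []; _∷_)
open import Data.List.Relation.Unary.All.Properties as All using (++⁺; ++⁻ˡ; ++⁻ʳ; map-∘;
  map-cong; all-filter; lookup-map)
open import Data.List.Relation.Unary.AllPairs using (AllPairs; []; _∷_)
open import Data.List.Relation.Unary.Any as Any using (Any; here; there)
open import Data.List.Relation.Unary.Any.Properties as Any using (any⁺; any⁻; lookup-index)
import Data.List.Properties as List
import Data.Vec.Properties as Vec
open import Data.Vec.Relation.Unary.All using ([]; _∷_) renaming (All to VAll)
import Data.List.Relation.Unary.Unique.DecSetoid.Properties as Unique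
open import Data.List.Relation.Unary.Unique.Propositional using (Unique)
import Data.List.Relation.Unary.Unique.Propositional.Properties as Unique
open import Data.Nat using (ℕ; zero; suc; _+_; _*_; _≤_; _<_; z≤n; s≤s; _≡ᵇ_; _≤ᵇ_; _/_; _%_)
import Data.Nat as ℕ
open import Data.Nat.DivMod using (m≡m%n+[m/n]*n; m%n<n; m<n*o⇒m/o<n; n/1≡n)
open import Data.Nat.Induction using (<-rec)
open import Data.Nat.Properties using (≤-refl; ≤-trans; ≤-antisym; <-≤-trans; <-irrefl; <-asym;
  <-cmp; +-monoˡ-<; +-mono-≤; *-monoˡ-≤; *-mono-≤; *-comm; ^-monoʳ-<; ^-monoˡ-≤; ^-*-assoc; <⇒≤;
  m≤m*n; n≢0⇒n>0; m^n≢0; ≰⇒>; <⇒≱; n≤0⇒n≡0; m≤n+m; m≤m+n; +-cancelʳ-<; ≮⇒≥; ≤⇒≯; ≡⇒≡ᵇ; ≡ᵇ⇒≡; ≤ᵇ⇒≤;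
  ≤⇒≤ᵇ; module ≤-Reasoning)
open import Data.Product using (∃; ∃-syntax; Σ-syntax; _×_; _,_; proj₁; proj₂)
open import Data.Product.Function.NonDependent.Propositional using (_×-⇔_)
open import Data.Sum as Sum using (_⊎_; inj₁; inj₂)
open import Data.Sum.Function.Propositional using (_⊎-⇔_)
open import Data.Unit using (tt)
open import Data.Vec as Vec using (Vec; []; _∷_)
open import Data.Vec.Relation.Binary.Pointwise.Inductive as Pointwise using (Pointwise; []; _∷_)
open import Function using (_∘_; id; _⇔_; mk⇔; Inverse; Equivalence)
open import Function.Construct.Identity using (⇔-id)
open import Function.Construct.Symmetry using (⇔-sym)
open import Function.Properties.Equivalence using () renaming (trans to infixr 0 _⨾_)
open import Function.Related.TypeIsomorphisms using (¬-cong-⇔)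
open import Level using (0ℓ)
open import Relation.Binary using (Rel; IsEquivalence; Decidable; tri<; tri≈; tri>)
import Relation.Binary.Construct.Closure.Equivalence as Eq
open import Relation.Binary.Construct.Closure.ReflexiveTransitive using (ε; _◅_)
open import Relation.Binary.Construct.Closure.Symmetric using (fwd; bwd)
open import Relation.Binary.PropositionalEquality as ≡ using (_≡_; refl; sym; trans; cong; cong₂;
  subst; subst₂)
open import Relation.Nullary using (Dec; ¬_; ⌊_⌋)
open import Relation.Nullary.Decidable using (toWitness; fromWitness; decidable-stable)
open import Relation.Nullary.Negation using (contradiction)
open Equivalence using (to; from)

-- Counting up to an equivalence

-- In general no formula over A picks one tuple from each class, and `count` counts single tuples,
-- so every count in Θ[A] has to become a count of classes. The only source of such a count is the
-- quotient built into `lrec`. For the same reason the translated recursion must identify all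
-- representatives of an element: otherwise the out-degrees compared with the labels, and the
-- in-degrees that divide the budget, would be multiplied by numbers of representatives.
--
-- The opposite danger is a tuple that represents nothing. Validity is a property of whole classes,
-- and every edge and every identification that comes from Θ[A] is guarded by it, so such a tuple
-- never joins a vertex of Θ[A] and never counts as a neighbour.
--
-- Correctness is stated through relations rather than functions, because an element has many
-- representatives and some tuples stand for no element. Two counts are then equal as soon as a
-- relation matches the classes on both sides.

record Card {X : Set} (_~_ : Rel X 0ℓ) (P : X → Set) (n : ℕ) : Set where
  field
    enum     : Fin n → X
    sound    : ∀ i → P (enum i)
    distinct : ∀ i j → enum i ~ enum j → i ≡ j
    complete : ∀ {x} → P x → ∃ λ i → x ~ enum i

open Card

-- Choosing a `ρ`-partner for each enumerated element gives an injection between index sets.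
-- Compatibility is phrased through a common `z`, so that neither relation has to be an equivalence
-- here.
card-≤ : ∀ {X Y : Set} {_~_ : Rel X 0ℓ} {_≈_ : Rel Y 0ℓ} {P : X → Set} {Q : Y → Set} {m n} →
         Card _~_ P m → Card _≈_ Q n → (ρ : X → Y → Set) →
         (∀ {x} → P x → ∃ λ y → ρ x y × Q y) →
         (∀ {x x′ y y′ z} → ρ x y → ρ x′ y′ → y ≈ z → y′ ≈ z → x ~ x′) → m ≤ n
card-≤ {_≈_ = _≈_} {m = m} {n} c c′ ρ total compat = Fin.injective⇒≤ {f = f} inj
  where
  partner : ∀ i → ∃ λ y → ρ (enum c i) y × _
  partner i = total (sound c i)

  image : ∀ i → ∃ λ j → proj₁ (partner i) ≈ enum c′ j
  image i = complete c′ (proj₂ (proj₂ (partner i)))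

  f : Fin m → Fin n
  f i = proj₁ (image i)

  inj : ∀ {i j} → f i ≡ f j → i ≡ j
  inj {i} {j} eq = distinct c i j (compat (proj₁ (proj₂ (partner i))) (proj₁ (proj₂ (partner j)))
    (proj₂ (image i)) (subst (λ k → _ ≈ enum c′ k) (sym eq) (proj₂ (image j))))

card-≡ : ∀ {X Y : Set} {_~_ : Rel X 0ℓ} {_≈_ : Rel Y 0ℓ} {P : X → Set} {Q : Y → Set} {m n} →
         IsEquivalence _~_ → IsEquivalence _≈_ →
         Card _~_ P m → Card _≈_ Q n → (ρ : X → Y → Set) →
         (∀ {x} → P x → ∃ λ y → ρ x y × Q y) → (∀ {y} → Q y → ∃ λ x → ρ x y × P x) →
         (∀ {x x′ y y′} → ρ x y → ρ x′ y′ → x ~ x′ ⇔ y ≈ y′) → m ≡ n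
card-≡ ~-eq ≈-eq c c′ ρ total surj compat = ≤-antisym
  (card-≤ c c′ ρ total λ r r′ p p′ → from (compat r r′) (≈.trans p (≈.sym p′)))
  (card-≤ c′ c (λ y x → ρ x y) surj λ r r′ p p′ → to (compat r r′) (~.trans p (~.sym p′)))
  where
  module ~ = IsEquivalence ~-eq
  module ≈ = IsEquivalence ≈-eq

-- For a side with no enumeration of its own, such as the tuples satisfying a translated formula:
-- the enumeration is pulled back from the other side.
card-transfer : ∀ {X Y : Set} {_~_ : Rel X 0ℓ} {_≈_ : Rel Y 0ℓ} {P : X → Set} {Q : Y → Set} {n} →
                Card _≈_ Q n → (ρ : X → Y → Set) →
                (∀ {x} → P x → ∃ λ y → ρ x y × Q y) → (∀ {y} → Q y → ∃ λ x → ρ x y × P x) →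
                (∀ {x x′ y y′} → ρ x y → ρ x′ y′ → x ~ x′ ⇔ y ≈ y′) → Card _~_ P n
card-transfer c ρ total surj compat = record
  { enum     = λ i → proj₁ (surj (sound c i))
  ; sound    = λ i → proj₂ (proj₂ (surj (sound c i)))
  ; distinct = λ i j p → distinct c i j
      (to (compat (proj₁ (proj₂ (surj (sound c i)))) (proj₁ (proj₂ (surj (sound c j))))) p)
  ; complete = λ p → let y , r , q = total p
                         i , y≈i   = complete c q
                     in i , from (compat r (proj₁ (proj₂ (surj (sound c i))))) y≈i
  }

lookup-distinct : ∀ {X : Set} {_~_ : Rel X 0ℓ} → IsEquivalence _~_ → ∀ {xs} → AllPairs (λ x y → ¬ x ~ y) xs →
                  ∀ i j → lookup xs i ~ lookup xs j → i ≡ j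
lookup-distinct ~-eq (d ∷ ds) zero    zero    p = refl
lookup-distinct ~-eq (d ∷ ds) zero    (suc j) p = contradiction p (All.lookup d (∈-lookup j))
lookup-distinct ~-eq (d ∷ ds) (suc i) zero    p =
  contradiction (IsEquivalence.sym ~-eq p) (All.lookup d (∈-lookup i))
lookup-distinct ~-eq (d ∷ ds) (suc i) (suc j) p = cong suc (lookup-distinct ~-eq ds i j p)

list-card : ∀ {X : Set} {_~_ : Rel X 0ℓ} {P : X → Set} → IsEquivalence _~_ → ∀ {xs} →
            AllPairs (λ x y → ¬ x ~ y) xs → All P xs → (∀ {x} → P x → Any (x ~_) xs) →
            Card _~_ P (length xs)
list-card ~-eq {xs} uniq snd cmpl = record
  { enum     = lookup xs
  ; sound    = λ i → All.lookup snd (∈-lookup i)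
  ; distinct = lookup-distinct ~-eq uniq
  ; complete = λ p → Any.index (cmpl p) , lookup-index (cmpl p)
  }

module _ {X : Set} {xs : List X} (covers : ∀ x → x ∈ xs) where

  filter-card : Unique xs → ∀ P → Card _≡_ (T ∘ P) (length (filterᵇ P xs))
  filter-card uniq P = list-card ≡.isEquivalence (Unique.filter⁺ (T? ∘ P) uniq)
    (all-filter (T? ∘ P) xs) (λ p → ∈-filter⁺ (T? ∘ P) (covers _) p)

  -- `P` need not respect `~`; what is counted are the classes that meet `P`. This covers the vertex
  -- counts of `lrec` as well as the universe of Θ[A], whose classes only have to meet `θV`.
  dedup-card : ∀ {_~_ : Rel X 0ℓ} → IsEquivalence _~_ → (~? : Decidable _~_) → ∀ P →
               Card _~_ (T ∘ P) (length (deduplicate ~? (filterᵇ P xs)))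
  dedup-card {_~_} ~-eq ~? P = list-card ~-eq
    (Unique.deduplicate-! (record { isDecEquivalence = record { isEquivalence = ~-eq ; _≟_ = ~? } })
      (filterᵇ P xs))
    (All.deduplicate⁺ ~? (all-filter (T? ∘ P) xs))
    (λ {x} p → Any.deduplicate⁺ ~? (λ r q → ~.trans q (~.sym r))
      (lose (∈-filter⁺ (T? ∘ P) (covers x) p) ~.refl))
    where module ~ = IsEquivalence ~-eq

below-card : ∀ n → Card _≡_ (_< n) n
below-card n = record
  { enum     = toℕ
  ; sound    = Fin.toℕ<n
  ; distinct = λ i j → Fin.toℕ-injective
  ; complete = λ x<n → Fin.fromℕ< x<n , sym (Fin.toℕ-fromℕ< x<n)
  }

-- Positional notation

-- A low digit below the base cannot make up for a smaller high part; the digit `e` on the larger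
-- side may be anything.
digit-< : ∀ {b d m n} e → d < b → m < n → d + m * b < e + n * b
digit-< {b} {d} {m} {n} e d<b m<n = begin-strict
  d + m * b  <⟨ +-monoˡ-< (m * b) d<b ⟩
  suc m * b  ≤⟨ *-monoˡ-≤ b m<n ⟩
  n * b      ≤⟨ m≤n+m (n * b) e ⟩
  e + n * b  ∎
  where open ≤-Reasoning

-- The recursion on which the formulae `ltT` and `ltE` are modelled: the high part decides, and the
-- low digit breaks ties.
digit-cmp : ∀ {b d e m n} → d < b → e < b → d + m * b < e + n * b ⇔ (m < n ⊎ (m ≡ n × d < e))
digit-cmp {b} {d} {e} {m} {n} d<b e<b = mk⇔ fw λ
  { (inj₁ m<n)          → digit-< e d<b m<n
  ; (inj₂ (refl , d<e)) → +-monoˡ-< (m * b) d<e }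
  where
  fw : d + m * b < e + n * b → m < n ⊎ (m ≡ n × d < e)
  fw p with <-cmp m n
  ... | tri< m<n _ _  = inj₁ m<n
  ... | tri≈ _ refl _ = inj₂ (refl , +-cancelʳ-< (m * b) d e p)
  ... | tri> _ _ n<m  = contradiction (digit-< d e<b n<m) (<-asym p)

digit-injective : ∀ {b d e m n} → d < b → e < b → d + m * b ≡ e + n * b → d ≡ e × m ≡ n
digit-injective {b} {d} {e} {m} {n} d<b e<b p with <-cmp m n
... | tri< m<n _ _  = contradiction (digit-< e d<b m<n) (<-irrefl p)
... | tri> _ _ n<m  = contradiction (digit-< d e<b n<m) (<-irrefl (sym p))
... | tri≈ _ refl _ with <-cmp d e
... | tri< d<e _ _ = contradiction (+-monoˡ-< (m * b) d<e) (<-irrefl p)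
... | tri≈ _ d≡e _ = d≡e , refl
... | tri> _ _ e<d = contradiction (+-monoˡ-< (m * b) e<d) (<-irrefl (sym p))

module _ {τ : Vocabulary} (A : Structure τ) where

  base : ℕ
  base = suc (size A)

  element : ∀ s → Dom A s
  element str = Inverse.from (finite A) (Fin.fromℕ< (ℕ.>-nonZero⁻¹ (size A)))
  element num = Fin.zero

  -- Numerals of a fixed width are unique, which is why plain equality can serve as similarity for
  -- translated number variables.
  value-injective : ∀ k {a b : A ^ nums k} → value A k a ≡ value A k b → a ≡ b
  value-injective zero    {[]}    {[]}    _  = refl
  value-injective (suc k) {x ∷ a} {y ∷ b} eq
    with digit-injective {base} {m = value A k a} {value A k b} (Fin.toℕ<n x) (Fin.toℕ<n y) eq
  ... | p , q = cong₂ _∷_ (Fin.toℕ-injective p) (value-injective k q)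

  value-bounded : ∀ k (a : A ^ nums k) → value A k a < base ℕ.^ k
  value-bounded zero    []      = s≤s z≤n
  value-bounded (suc k) (x ∷ a) = begin-strict
    toℕ x + value A k a * base  <⟨ +-monoˡ-< (value A k a * base) (Fin.toℕ<n x) ⟩
    suc (value A k a) * base    ≤⟨ *-monoˡ-≤ base (value-bounded k a) ⟩
    base ℕ.^ k * base           ≡⟨ *-comm (base ℕ.^ k) base ⟩
    base ℕ.* base ℕ.^ k         ∎
    where open ≤-Reasoning

  value-surjective : ∀ k m → m < base ℕ.^ k → ∃ λ (a : A ^ nums k) → value A k a ≡ m
  value-surjective zero    zero    _        = [] , refl
  value-surjective zero    (suc m) (s≤s ())
  value-surjective (suc k) m m< with value-surjective k (m / base)
    (m<n*o⇒m/o<n {n = base ℕ.^ k} (subst (m <_) (*-comm base (base ℕ.^ k)) m<))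
  ... | a , eq = Fin.fromℕ< (m%n<n m base) ∷ a , (begin
    toℕ (Fin.fromℕ< (m%n<n m base)) + value A k a * base
      ≡⟨ cong₂ (λ x y → x + y * base) (Fin.toℕ-fromℕ< (m%n<n m base)) eq ⟩
    m % base + m / base * base
      ≡⟨ m≡m%n+[m/n]*n m base ⟨
    m ∎)
    where open ≡.≡-Reasoning

  elements-unique : ∀ s → Unique (elements A s)
  elements-unique str = Unique.map⁺ inj (Unique.allFin⁺ (size A))
    where
    inj : ∀ {i j} → Inverse.from (finite A) i ≡ Inverse.from (finite A) j → i ≡ j
    inj {i} {j} eq = trans (sym (Inverse.strictlyInverseˡ (finite A) i))
      (trans (cong (Inverse.to (finite A)) eq) (Inverse.strictlyInverseˡ (finite A) j))
  elements-unique num = Unique.allFin⁺ (suc (size A))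

  tuples-unique : ∀ ts → Unique (tuples A ts)
  tuples-unique []       = [] ∷ []
  tuples-unique (t ∷ ts) = Unique.cartesianProductWith⁺ _∷_ (λ { refl → refl , refl })
    (elements-unique t) (tuples-unique ts)

  elements-length : ∀ s → length (elements A s) ≤ base
  elements-length str rewrite length-map (Inverse.from (finite A)) (allFin (size A))
    | length-tabulate {n = size A} id = m≤n+m (size A) 1
  elements-length num rewrite length-tabulate {n = size A} (Fin.suc {n = size A}) = ≤-refl

length-cartesianProductWith : ∀ {X Y Z : Set} (f : X → Y → Z) xs ys →
                              length (cartesianProductWith f xs ys) ≡ length xs * length ys
length-cartesianProductWith f []       ys = refl
length-cartesianProductWith f (x ∷ xs) ys = trans (length-++ (map (f x) ys))
  (cong₂ _+_ (length-map (f x) ys) (length-cartesianProductWith f xs ys))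

tuples-length : ∀ {τ} (A : Structure τ) ts → length (tuples A ts) ≤ base A ℕ.^ length ts
tuples-length A []       = ≤-refl
tuples-length A (t ∷ ts) = begin
  length (tuples A (t ∷ ts))
    ≡⟨ length-cartesianProductWith _∷_ (elements A t) (tuples A ts) ⟩
  length (elements A t) * length (tuples A ts)
    ≤⟨ *-mono-≤ (elements-length A t) (tuples-length A ts) ⟩
  base A * base A ℕ.^ length ts
    ∎
  where open ≤-Reasoning

-- Boolean tests as propositions

∃-⇔ : ∀ {X : Set} {P Q : X → Set} → (∀ x → P x ⇔ Q x) → ∃ P ⇔ ∃ Q
∃-⇔ P⇔Q = mk⇔ (λ (x , p) → x , to (P⇔Q x) p) (λ (x , q) → x , from (P⇔Q x) q)

T-⌊⌋ : ∀ {P : Set} (P? : Dec P) → T ⌊ P? ⌋ ⇔ P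
T-⌊⌋ P? = mk⇔ toWitness fromWitness

T-not : ∀ {b} → T (not b) ⇔ (¬ T b)
T-not {true}  = mk⇔ (λ ()) (λ ¬t → ¬t tt)
T-not {false} = mk⇔ (λ _ ()) (λ _ → tt)

T-injective : ∀ {a b} → T a ⇔ T b → a ≡ b
T-injective {true}  {true}  _ = refl
T-injective {false} {false} _ = refl
T-injective {true}  {false} e = ⊥-elim (to e tt)
T-injective {false} {true}  e = ⊥-elim (from e tt)

T-any : ∀ {X : Set} {xs : List X} → (∀ x → x ∈ xs) → ∀ p → T (any p xs) ⇔ ∃ (T ∘ p)
T-any {xs = xs} covers p = mk⇔ (λ t → Any.satisfied (any⁻ p xs t))
                               (λ (x , px) → any⁺ p (lose (covers x) px))

T-≡ᵇ : ∀ {m n} → T (m ≡ᵇ n) ⇔ m ≡ n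
T-≡ᵇ {m} {n} = mk⇔ (≡ᵇ⇒≡ m n) (≡⇒≡ᵇ m n)

-- Edges, labels and class counts of the recursion graph

module _ {τ : Vocabulary} (A : Structure τ) {ts : Ctx} where

  T-anyTuple : ∀ p → T (any p (tuples A ts)) ⇔ ∃ (T ∘ p)
  T-anyTuple = T-any (tuples-complete A)

  Gen-isEquivalence : ∀ r → IsEquivalence (Gen A {ts} r)
  Gen-isEquivalence r = Eq.isEquivalence _

  module _ {k : ℕ} (r₌ rE : A ^ ts → A ^ ts → Bool) (rC : A ^ ts → A ^ nums k → Bool) where
    open LRec A ts {k} r₌ rE rC

    T-edge : ∀ {a b} → T (edge a b) ⇔ (∃[ a′ ] ∃[ b′ ] (a ∼ a′ × b ∼ b′ × T (rE a′ b′)))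
    T-edge {a} {b} = T-anyTuple _ ⨾ ∃-⇔ λ a′ → T-anyTuple _ ⨾ ∃-⇔ λ b′ →
      T-∧ ⨾ T-⌊⌋ (a ∼? a′) ×-⇔ (T-∧ ⨾ T-⌊⌋ (b ∼? b′) ×-⇔ ⇔-id _)

    T-label : ∀ {a m} → T (label a m) ⇔ (∃[ a′ ] (a ∼ a′ × ∃[ n ] (T (rC a′ n) × value A k n ≡ m)))
    T-label {a} {m} = T-anyTuple _ ⨾ ∃-⇔ λ a′ → T-any (tuples-complete A) _ ⨾
      (∃-⇔ λ n → T-∧ ⨾ T-⌊⌋ (a ∼? a′) ×-⇔ (T-∧ ⨾ ⇔-id _ ×-⇔ T-≡ᵇ)) ⨾
      mk⇔ (λ (n , p , q) → p , n , q) (λ (p , n , q) → n , p , q)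

    classes-card : ∀ P → Card _∼_ (T ∘ P) (classes P)
    classes-card = dedup-card (tuples-complete A) (Gen-isEquivalence r₌) _∼?_

-- The set X depends only on the quotient graph with its labels, so it is
-- preserved by any correspondence between (parts of) the vertex tuples.
module Simulation {τ σ : Vocabulary} (A : Structure τ) (B : Structure σ) {ts us : Ctx} {k j : ℕ}
  {r₌ rE : A ^ ts → A ^ ts → Bool} {rC : A ^ ts → A ^ nums k → Bool}
  {s₌ sE : B ^ us → B ^ us → Bool} {sC : B ^ us → B ^ nums j → Bool}
  (_⊳_ : A ^ ts → B ^ us → Set)
  (total  : ∀ b → ∃ λ a → a ⊳ b)
  (closed : ∀ {a b a′} → a ⊳ b → Gen A r₌ a a′ → ∃ λ b′ → a′ ⊳ b′)
  (∼-iff  : ∀ {a b a′ b′} → a ⊳ b → a′ ⊳ b′ → Gen A r₌ a a′ ⇔ Gen B s₌ b b′)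
  (E-dom  : ∀ {a a′} → T (rE a a′) → ∃ (a ⊳_) × ∃ (a′ ⊳_))
  (E-iff  : ∀ {a b a′ b′} → a ⊳ b → a′ ⊳ b′ → T (rE a a′) ⇔ T (sE b b′))
  (C-iff  : ∀ {a b} → a ⊳ b → ∀ m →
            (∃[ n ] (T (rC a n) × value A k n ≡ m)) ⇔ (∃[ n ] (T (sC b n) × value B j n ≡ m)))
  where

  private
    module M = LRec A ts {k} r₌ rE rC
    module N = LRec B us {j} s₌ sE sC
    module M∼ = IsEquivalence (Gen-isEquivalence A r₌)
    module N∼ = IsEquivalence (Gen-isEquivalence B s₌)

  edge-sim : ∀ {a b a′ b′} → a ⊳ b → a′ ⊳ b′ → M.edge a a′ ≡ N.edge b b′
  edge-sim {a} {b} {a′} {b′} p p′ = T-injective (mk⇔ fw bw)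
    where
    fw : T (M.edge a a′) → T (N.edge b b′)
    fw e =
      let _ , _ , a∼c , a′∼c′ , e₀ = to (T-edge A r₌ rE rC) e
          (d , q) , (d′ , q′)      = E-dom e₀
      in from (T-edge B s₌ sE sC)
           (d , d′ , to (∼-iff p q) a∼c , to (∼-iff p′ q′) a′∼c′ , to (E-iff q q′) e₀)
    bw : T (N.edge b b′) → T (M.edge a a′)
    bw e =
      let d , d′ , b∼d , b′∼d′ , e₀ = to (T-edge B s₌ sE sC) e
          c , q   = total d
          c′ , q′ = total d′
      in from (T-edge A r₌ rE rC)
           (c , c′ , from (∼-iff p q) b∼d , from (∼-iff p′ q′) b′∼d′ , from (E-iff q q′) e₀)

  -- An edge between classes stems from an edge between members. Those members are in the domain of
  -- `⊳`, and `closed` spreads this over their classes.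
  edge-dom : ∀ {a a′} → T (M.edge a a′) → ∃ (a ⊳_) × ∃ (a′ ⊳_)
  edge-dom e =
    let _ , _ , a∼c , a′∼c′ , e₀ = to (T-edge A r₌ rE rC) e
        (_ , q) , (_ , q′)       = E-dom e₀
    in closed q (M∼.sym a∼c) , closed q′ (M∼.sym a′∼c′)

  label-sim : ∀ {a b} → a ⊳ b → ∀ m → M.label a m ≡ N.label b m
  label-sim {a} {b} p m = T-injective (mk⇔ fw bw)
    where
    fw : T (M.label a m) → T (N.label b m)
    fw l =
      let c , a∼c , n = to (T-label A r₌ rE rC) l
          d , q       = closed p a∼c
      in from (T-label B s₌ sE sC) (d , to (∼-iff p q) a∼c , to (C-iff q m) n)
    bw : T (N.label b m) → T (M.label a m)
    bw l =
      let d , b∼d , n = to (T-label B s₌ sE sC) l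
          c , q       = total d
      in from (T-label A r₌ rE rC) (c , from (∼-iff p q) b∼d , from (C-iff q m) n)

  -- The first hypothesis keeps classes without a counterpart in B out of the count on the A side;
  -- on the B side `total` leaves none out.
  classes-sim : ∀ {P Q} → (∀ {a} → T (P a) → ∃ (a ⊳_)) → (∀ {a b} → a ⊳ b → P a ≡ Q b) →
                M.classes P ≡ N.classes Q
  classes-sim {P} {Q} dom P≡Q = card-≡ (Gen-isEquivalence A r₌) (Gen-isEquivalence B s₌)
    (classes-card A r₌ rE rC P) (classes-card B s₌ sE sC Q) _⊳_
    (λ t → proj₁ (dom t) , proj₂ (dom t) , subst T (P≡Q (proj₂ (dom t))) t)
    (λ {b} t → proj₁ (total b) , proj₂ (total b) , subst T (sym (P≡Q (proj₂ (total b)))) t)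
    ∼-iff

  inX-sim : ∀ ℓ {a b} → a ⊳ b → M.inX a ℓ ≡ N.inX b ℓ
  inX-sim = <-rec _ step
    where
    step : ∀ ℓ → (∀ {m} → m < ℓ → ∀ {a b} → a ⊳ b → M.inX a m ≡ N.inX b m) →
           ∀ {a b} → a ⊳ b → M.inX a ℓ ≡ N.inX b ℓ
    step zero    rec         p = refl
    step (suc ℓ) rec {a} {b} p = begin
      M.inX a (suc ℓ)
        ≡⟨ M.inX-suc a ℓ ⟩
      M.label a (M.classes λ d → M.edge a d ∧ M.inX d (ℓ ÷ M.inDegree d))
        ≡⟨ cong (M.label a) (classes-sim (λ t → proj₂ (edge-dom (proj₁ (to T-∧ t)))) λ {d} {d′} q →
             cong₂ _∧_ (edge-sim p q) (trans
               -- The in-degrees are equated before the induction hypothesis is applied, so that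
               -- both recursions continue with the same budget, and `÷-<` makes it smaller whatever
               -- the in-degree is.
               (cong (λ n → M.inX d (ℓ ÷ n))
                 (classes-sim (λ t → proj₁ (edge-dom t)) (λ q′ → edge-sim q′ q)))
               (rec (÷-< ℓ (N.inDegree d′)) q))) ⟩
      M.label a (N.classes λ d → N.edge b d ∧ N.inX d (ℓ ÷ N.inDegree d))
        ≡⟨ label-sim p _ ⟩
      N.label b (N.classes λ d → N.edge b d ∧ N.inX d (ℓ ÷ N.inDegree d))
        ≡⟨ N.inX-suc b ℓ ⟨
      N.inX b (suc ℓ)
        ∎
      where open ≡.≡-Reasoning

-- Tuples of variables and renaming

-- Also used as renamings: a tuple of type Γ over Δ sends each variable of Γ to one of Δ, and
-- renaming a formula amounts to evaluating this tuple.
Vars : Ctx → Ctx → Set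
Vars Δ ts = All (_∈ Δ) ts

inˡ : ∀ {ts Δ} → Vars (ts ++ Δ) ts
inˡ {[]}     = []
inˡ {t ∷ ts} = here refl ∷ All.map there inˡ

wk : ∀ ts {Δ us} → Vars Δ us → Vars (ts ++ Δ) us
wk ts = All.map (∈-++⁺ʳ ts)

allVars : ∀ {Δ} → Vars Δ Δ
allVars {[]}    = []
allVars {t ∷ Δ} = here refl ∷ All.map there allVars

lift : ∀ ts {Γ Δ} → Vars Δ Γ → Vars (ts ++ Δ) (ts ++ Γ)
lift ts ρ = ++⁺ inˡ (wk ts ρ)

map-++⁺ : ∀ {X : Set} {P Q : X → Set} {f : ∀ {x} → P x → Q x} {xs ys} (ps : All P xs) (qs : All P ys) →
          All.map f (++⁺ ps qs) ≡ ++⁺ (All.map f ps) (All.map f qs)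
map-++⁺ []       qs = refl
map-++⁺ (p ∷ ps) qs = cong (_ ∷_) (map-++⁺ ps qs)

module _ {P : Sort → Set} where

  ++⁻ˡ-++⁺ : ∀ {ts us} (ps : All P ts) (qs : All P us) → ++⁻ˡ ts (++⁺ ps qs) ≡ ps
  ++⁻ˡ-++⁺ []       qs = refl
  ++⁻ˡ-++⁺ (p ∷ ps) qs = cong (p ∷_) (++⁻ˡ-++⁺ ps qs)

  ++⁻ʳ-++⁺ : ∀ {ts us} (ps : All P ts) (qs : All P us) → ++⁻ʳ ts (++⁺ ps qs) ≡ qs
  ++⁻ʳ-++⁺ []       qs = refl
  ++⁻ʳ-++⁺ (p ∷ ps) qs = ++⁻ʳ-++⁺ ps qs

  ++⁺-++⁻ : ∀ ts {us} (ps : All P (ts ++ us)) → ++⁺ (++⁻ˡ ts ps) (++⁻ʳ ts ps) ≡ ps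
  ++⁺-++⁻ []       ps       = refl
  ++⁺-++⁻ (t ∷ ts) (p ∷ ps) = cong (p ∷_) (++⁺-++⁻ ts ps)

map-++⁻ˡ : ∀ {P Q : Sort → Set} {f : ∀ {s} → P s → Q s} ts {us} (ps : All P (ts ++ us)) →
           All.map f (++⁻ˡ ts ps) ≡ ++⁻ˡ ts (All.map f ps)
map-++⁻ˡ []       ps       = refl
map-++⁻ˡ (t ∷ ts) (p ∷ ps) = cong (_ ∷_) (map-++⁻ˡ ts ps)

map-++⁻ʳ : ∀ {P Q : Sort → Set} {f : ∀ {s} → P s → Q s} ts {us} (ps : All P (ts ++ us)) →
           All.map f (++⁻ʳ ts ps) ≡ ++⁻ʳ ts (All.map f ps)
map-++⁻ʳ []       ps       = refl
map-++⁻ʳ (t ∷ ts) (p ∷ ps) = map-++⁻ʳ ts ps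

sub : ∀ {τ Γ Δ} → Formula τ Γ → Vars Δ Γ → Formula τ Δ
sub (equal x y)  ρ = equal (All.lookup ρ x) (All.lookup ρ y)
sub (rel R xs)   ρ = rel R (Vec.map (All.lookup ρ) xs)
sub (leq p q)    ρ = leq (All.lookup ρ p) (All.lookup ρ q)
sub (¬′ φ)       ρ = ¬′ sub φ ρ
sub (φ ∧′ ψ)     ρ = sub φ ρ ∧′ sub ψ ρ
sub (φ ∨′ ψ)     ρ = sub φ ρ ∨′ sub ψ ρ
sub (∃′ s φ)     ρ = ∃′ s (sub φ (lift (s ∷ []) ρ))
sub (∀′ s φ)     ρ = ∀′ s (sub φ (lift (s ∷ []) ρ))
sub (count ts ψ p) ρ = count ts (sub ψ (lift ts ρ)) (All.map (All.lookup ρ) p)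
sub (lrec ts {k} φ₌ φE φC w r) ρ = lrec ts
  (sub φ₌ (lift ts (lift ts ρ))) (sub φE (lift ts (lift ts ρ))) (sub φC (lift ts (lift (nums (suc k)) ρ)))
  (All.map (All.lookup ρ) w) (All.map (All.lookup ρ) r)

module _ {τ : Vocabulary} {A : Structure τ} where

  eval : ∀ {Δ ts} → A ^ Δ → Vars Δ ts → A ^ ts
  eval β = All.map (All.lookup β)

  lookup-++ʳ : ∀ {ts Δ s} (a : A ^ ts) (β : A ^ Δ) (x : s ∈ Δ) →
               All.lookup (++⁺ a β) (∈-++⁺ʳ ts x) ≡ All.lookup β x
  lookup-++ʳ []      β x = refl
  lookup-++ʳ (_ ∷ a) β x = lookup-++ʳ a β x

  eval-wk : ∀ {ts Δ us} (a : A ^ ts) (β : A ^ Δ) (w : Vars Δ us) → eval (++⁺ a β) (wk ts w) ≡ eval β w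
  eval-wk a β w = trans (map-∘ w) (map-cong w (lookup-++ʳ a β))

  eval-inˡ : ∀ {ts Δ} (a : A ^ ts) (β : A ^ Δ) → eval (++⁺ a β) inˡ ≡ a
  eval-inˡ []      β = refl
  eval-inˡ (x ∷ a) β = cong (x ∷_) (trans (map-∘ inˡ) (eval-inˡ a β))

  eval-allVars : ∀ {Δ} (β : A ^ Δ) → eval β allVars ≡ β
  eval-allVars []      = refl
  eval-allVars (x ∷ β) = cong (x ∷_) (trans (map-∘ allVars) (eval-allVars β))

  eval-lift : ∀ {ts Γ Δ} (a : A ^ ts) (β : A ^ Δ) (ρ : Vars Δ Γ) →
              eval (++⁺ a β) (lift ts ρ) ≡ ++⁺ a (eval β ρ)
  eval-lift {ts} a β ρ = trans (map-++⁺ (inˡ {ts}) (wk ts ρ)) (cong₂ ++⁺ (eval-inˡ a β) (eval-wk a β ρ))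

  eval-∘ : ∀ {Γ Δ us} (β : A ^ Δ) (ρ : Vars Δ Γ) (w : Vars Γ us) →
           eval β (All.map (All.lookup ρ) w) ≡ eval (eval β ρ) w
  eval-∘ β ρ w = trans (map-∘ w) (map-cong w (λ x → sym (lookup-map ρ x)))

  eval-lift₂ : ∀ {ts us Γ Δ} (a : A ^ ts) (b : A ^ us) (β : A ^ Δ) (ρ : Vars Δ Γ) →
               eval (++⁺ a (++⁺ b β)) (lift ts (lift us ρ)) ≡ ++⁺ a (++⁺ b (eval β ρ))
  eval-lift₂ a b β ρ = trans (eval-lift a _ _) (cong (++⁺ a) (eval-lift b β ρ))

module _ {τ : Vocabulary} (A : Structure τ) where

  Gen-cong : ∀ {ts} {r s : A ^ ts → A ^ ts → Bool} → (∀ a b → r a b ≡ s a b) →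
             ∀ {a b} → Gen A r a b ⇔ Gen A s a b
  Gen-cong eq = mk⇔ (Eq.map (subst T (eq _ _))) (Eq.map (subst T (sym (eq _ _))))

  -- Equality is itself a simulation, so pointwise agreement of the graphs is enough and function
  -- extensionality is avoided.
  inX-cong : ∀ {ts k} {r₌ rE s₌ sE : A ^ ts → A ^ ts → Bool} {rC sC : A ^ ts → A ^ nums k → Bool} →
             (∀ a b → r₌ a b ≡ s₌ a b) → (∀ a b → rE a b ≡ sE a b) → (∀ a n → rC a n ≡ sC a n) →
             ∀ ℓ a → LRec.inX A ts {k} r₌ rE rC a ℓ ≡ LRec.inX A ts {k} s₌ sE sC a ℓ
  inX-cong eq₌ eqE eqC ℓ a = Simulation.inX-sim A A _≡_
    (λ b → b , refl) (λ _ _ → _ , refl) (λ { refl refl → Gen-cong eq₌ })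
    (λ _ → (_ , refl) , (_ , refl))
    (λ { {a} {_} {a′} refl refl → mk⇔ (subst T (eqE a a′)) (subst T (sym (eqE a a′))) })
    (λ { {a} refl m → ∃-⇔ λ n → mk⇔ (subst T (eqC a n)) (subst T (sym (eqC a n))) ×-⇔ ⇔-id _ })
    ℓ refl

  sub-correct : ∀ {Γ Δ} (φ : Formula τ Γ) (ρ : Vars Δ Γ) (β : A ^ Δ) →
                A ⟦ sub φ ρ ⟧ β ≡ A ⟦ φ ⟧ eval β ρ
  sub-correct (equal {s} x y) ρ β =
    cong₂ (λ a b → ⌊ dom-≟ A s a b ⌋) (sym (lookup-map ρ x)) (sym (lookup-map ρ y))
  sub-correct (rel R xs) ρ β = cong (interp A R) (trans (sym (Vec.map-∘ (All.lookup β) (All.lookup ρ) xs))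
    (Vec.map-cong (λ x → sym (lookup-map ρ x)) xs))
  sub-correct (leq p q) ρ β =
    cong₂ (λ a b → toℕ a ≤ᵇ toℕ b) (sym (lookup-map ρ p)) (sym (lookup-map ρ q))
  sub-correct (¬′ φ) ρ β = cong not (sub-correct φ ρ β)
  sub-correct (φ ∧′ ψ) ρ β = cong₂ _∧_ (sub-correct φ ρ β) (sub-correct ψ ρ β)
  sub-correct (φ ∨′ ψ) ρ β = cong₂ _∨_ (sub-correct φ ρ β) (sub-correct ψ ρ β)
  sub-correct (∃′ s φ) ρ β = cong or (List.map-cong
    (λ a → trans (sub-correct φ _ _) (cong (A ⟦ φ ⟧_) (eval-lift (a ∷ []) β ρ))) (elements A s))
  sub-correct (∀′ s φ) ρ β = cong and (List.map-cong
    (λ a → trans (sub-correct φ _ _) (cong (A ⟦ φ ⟧_) (eval-lift (a ∷ []) β ρ))) (elements A s))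
  sub-correct (count ts {k} ψ p) ρ β = cong₂ _≡ᵇ_
    (cong length (filter-≐ (T? ∘ _) (T? ∘ _)
      ((λ {a} → subst T (eq a)) , (λ {a} → subst T (sym (eq a)))) (tuples A ts)))
    (cong (value A k) (eval-∘ β ρ p))
    where
    eq : ∀ a → A ⟦ sub ψ (lift ts ρ) ⟧ (++⁺ a β) ≡ A ⟦ ψ ⟧ (++⁺ a (eval β ρ))
    eq a = trans (sub-correct ψ _ _) (cong (A ⟦ ψ ⟧_) (eval-lift a β ρ))
  sub-correct (lrec ts {k} {j} φ₌ φE φC w r) ρ β = trans
    (inX-cong (λ a b → trans (sub-correct φ₌ _ _) (cong (A ⟦ φ₌ ⟧_) (eval-lift₂ a b β ρ)))
              (λ a b → trans (sub-correct φE _ _) (cong (A ⟦ φE ⟧_) (eval-lift₂ a b β ρ)))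
              (λ a n → trans (sub-correct φC _ _) (cong (A ⟦ φC ⟧_) (eval-lift₂ a n β ρ)))
              (value A (suc j) (eval β (All.map (All.lookup ρ) r))) _)
    (cong₂ (LRec.inX A ts {suc k} _ _ _) (eval-∘ β ρ w) (cong (value A (suc j)) (eval-∘ β ρ r)))

-- Basic formulae

false′ true′ : ∀ {τ Δ} → Formula τ Δ
false′ = ∃′ num (¬′ equal (here refl) (here refl))
true′  = ¬′ false′

∃* : ∀ {τ Δ} ts → Formula τ (ts ++ Δ) → Formula τ Δ
∃* []       φ = φ
∃* (t ∷ ts) φ = ∃* ts (∃′ t φ)

eqT : ∀ {τ Δ ts} → Vars Δ ts → Vars Δ ts → Formula τ Δ
eqT []       []       = true′
eqT (x ∷ xs) (y ∷ ys) = equal x y ∧′ eqT xs ys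

isZero : ∀ {τ Δ} → num ∈ Δ → Formula τ Δ
isZero x = ∀′ num (leq (there x) (here refl))

ltT : ∀ {τ Δ} k → Vars Δ (nums k) → Vars Δ (nums k) → Formula τ Δ
ltT zero    []       []       = false′
ltT (suc k) (x ∷ xs) (y ∷ ys) = ltT k xs ys ∨′ (eqT xs ys ∧′ ¬′ leq y x)

module _ {τ : Vocabulary} (A : Structure τ) where

  ⊨-¬ : ∀ {Δ} {φ : Formula τ Δ} {β} → A ⊨ ¬′ φ [ β ] ⇔ (¬ A ⊨ φ [ β ])
  ⊨-¬ = T-not

  ⊨-∃ : ∀ {Δ s} {φ : Formula τ (s ∷ Δ)} {β} → A ⊨ ∃′ s φ [ β ] ⇔ (∃[ a ] A ⊨ φ [ a ∷ β ])
  ⊨-∃ {s = s} = T-any (elements-complete A s) _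

  ⊨-∀ : ∀ {Δ s} {φ : Formula τ (s ∷ Δ)} {β} → A ⊨ ∀′ s φ [ β ] ⇔ (∀ a → A ⊨ φ [ a ∷ β ])
  ⊨-∀ {s = s} = mk⇔ (λ t a → All.lookup (All.all⁺ _ (elements A s) t) (elements-complete A s a))
                    (λ f → All.all⁻ _ (All.universal f (elements A s)))

  ⊨-∃* : ∀ {Δ} ts {φ : Formula τ (ts ++ Δ)} {β} →
         A ⊨ ∃* ts φ [ β ] ⇔ (∃[ a ] A ⊨ φ [ ++⁺ {xs = ts} a β ])
  ⊨-∃* []       = mk⇔ (λ p → [] , p) (λ { ([] , p) → p })
  ⊨-∃* (t ∷ ts) {φ} = ⊨-∃* ts ⨾ (∃-⇔ λ _ → ⊨-∃ {φ = φ}) ⨾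
    mk⇔ (λ (a , x , p) → x ∷ a , p) (λ { (x ∷ a , p) → a , x , p })

  ⊨-false : ∀ {Δ} {β : A ^ Δ} → ¬ A ⊨ false′ [ β ]
  ⊨-false {β = β} t =
    let a , p = to (⊨-∃ {s = num} {φ = ¬′ equal {s = num} (here refl) (here refl)} {β}) t
    in to T-not p (from (T-⌊⌋ (a Fin.≟ a)) refl)

  ⊨-true : ∀ {Δ} {β : A ^ Δ} → A ⊨ true′ [ β ]
  ⊨-true {β = β} = from (⊨-¬ {φ = false′} {β}) (⊨-false {β = β})

  ⊨-equal : ∀ {Δ s} {x y : s ∈ Δ} {β : A ^ Δ} →
            A ⊨ equal x y [ β ] ⇔ All.lookup β x ≡ All.lookup β y
  ⊨-equal {s = s} = T-⌊⌋ (dom-≟ A s _ _)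

  ⊨-eqT : ∀ {Δ ts} (x y : Vars Δ ts) {β : A ^ Δ} → A ⊨ eqT x y [ β ] ⇔ eval β x ≡ eval β y
  ⊨-eqT []       []       {β} = mk⇔ (λ _ → refl) (λ _ → ⊨-true {β = β})
  ⊨-eqT (x ∷ xs) (y ∷ ys) {β} = T-∧ ⨾ (⊨-equal {x = x} {y} {β} ×-⇔ ⊨-eqT xs ys) ⨾
    mk⇔ (λ (p , q) → cong₂ _∷_ p q) (λ p → cong All.head p , cong All.tail p)

  ⊨-leq : ∀ {Δ} {x y : num ∈ Δ} {β : A ^ Δ} →
          A ⊨ leq x y [ β ] ⇔ toℕ (All.lookup β x) ≤ toℕ (All.lookup β y)
  ⊨-leq = mk⇔ (≤ᵇ⇒≤ _ _) ≤⇒≤ᵇ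

  ⊨-isZero : ∀ {Δ} (x : num ∈ Δ) {β : A ^ Δ} → A ⊨ isZero x [ β ] ⇔ All.lookup β x ≡ Fin.zero
  ⊨-isZero x {β} = ⊨-∀ {s = num} {leq (there x) (here refl)} {β} ⨾ mk⇔
    (λ f → Fin.toℕ-injective (n≤0⇒n≡0 (≤ᵇ⇒≤ _ _ (f Fin.zero))))
    (λ eq a → ≤⇒≤ᵇ (subst (λ b → toℕ b ≤ toℕ a) (sym eq) z≤n))

  ⊨-ltT : ∀ {Δ} k (x y : Vars Δ (nums k)) {β : A ^ Δ} →
          A ⊨ ltT k x y [ β ] ⇔ value A k (eval β x) < value A k (eval β y)
  ⊨-ltT zero    []       []       {β} = mk⇔ (λ p → ⊥-elim (⊨-false {β = β} p)) (λ ())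
  ⊨-ltT (suc k) (x ∷ xs) (y ∷ ys) {β} =
    T-∨ ⨾ (⊨-ltT k xs ys ⊎-⇔ (T-∧ ⨾
      (⊨-eqT xs ys ⨾ mk⇔ (cong (value A k)) (value-injective A k))
      ×-⇔ (T-not ⨾ ¬-cong-⇔ (⊨-leq {x = y} {x} {β}) ⨾ mk⇔ ≰⇒> <⇒≱)))
    ⨾ ⇔-sym (digit-cmp (Fin.toℕ<n _) (Fin.toℕ<n _))

  ⊨-sub : ∀ {Γ Δ} (φ : Formula τ Γ) (ρ : Vars Δ Γ) (β : A ^ Δ) →
          A ⊨ sub φ ρ [ β ] ⇔ A ⊨ φ [ eval β ρ ]
  ⊨-sub φ ρ β = mk⇔ (subst T (sub-correct A φ ρ β)) (subst T (sym (sub-correct A φ ρ β)))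

  ⟦_⟧₂ : ∀ {ts Δ} → Formula τ (ts ++ ts ++ Δ) → A ^ Δ → A ^ ts → A ^ ts → Bool
  ⟦ S ⟧₂ β a b = A ⟦ S ⟧ (++⁺ a (++⁺ b β))

-- With no edges and the budget 1, X only tests whether the class of a
-- contains a tuple labelled by 0.
opaque
  gen : ∀ {τ Δ ts} → Formula τ (ts ++ ts ++ Δ) → Vars Δ ts → Vars Δ ts → Formula τ Δ
  gen {ts = ts} S a b = ∃′ num (lrec ts {0} {0}
    (sub S (lift ts (lift ts (wk (num ∷ []) allVars))))
    false′
    (eqT inˡ (wk ts (wk (nums 1) (wk (num ∷ []) b))))
    (wk (num ∷ []) a) (here refl ∷ []))

module _ {τ : Vocabulary} (A : Structure τ) {ts : Ctx} {k : ℕ}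
         (r₌ rE : A ^ ts → A ^ ts → Bool) (rC : A ^ ts → A ^ nums k → Bool) where
  open LRec A ts {k} r₌ rE rC

  -- Without out-neighbours the recursion stops after one step and compares the count 0 with the
  -- labels.
  inX-isolated : ∀ {a} ℓ → (∀ b → ¬ T (edge a b)) → T (inX a ℓ) ⇔ (0 < ℓ × T (label a 0))
  inX-isolated {a} zero    isolated = mk⇔ (λ ()) (λ ())
  inX-isolated {a} (suc ℓ) isolated = mk⇔ (λ t → s≤s z≤n , subst T eq t) (λ (_ , t) → subst T (sym eq) t)
    where
    eq : inX a (suc ℓ) ≡ label a 0
    eq = trans (inX-suc a ℓ) (cong (label a) (card-≡ (Gen-isEquivalence A r₌) ≡.isEquivalence
      (classes-card A r₌ rE rC _) (below-card 0) (λ _ _ → ⊥)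
      (λ t → ⊥-elim (isolated _ (proj₁ (to T-∧ t)))) (λ ()) (λ ())))

module _ {τ : Vocabulary} (A : Structure τ) where

  opaque
    unfolding gen

    ⊨-gen : ∀ {Δ ts} (S : Formula τ (ts ++ ts ++ Δ)) (a b : Vars Δ ts) (β : A ^ Δ) →
            A ⊨ gen S a b [ β ] ⇔ Gen A (⟦_⟧₂ A S β) (eval β a) (eval β b)
    ⊨-gen {Δ} {ts} S a b β = ⊨-∃ A {φ = φ} {β} ⨾ mk⇔ fw bw
      where
      φ₌ : Formula τ (ts ++ ts ++ num ∷ Δ)
      φ₌ = sub S (lift ts (lift ts (wk (num ∷ []) allVars)))
      φC : Formula τ (ts ++ nums 1 ++ num ∷ Δ)
      φC = eqT inˡ (wk ts (wk (nums 1) (wk (num ∷ []) b)))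
      φ : Formula τ (num ∷ Δ)
      φ = lrec ts {0} {0} φ₌ false′ φC (wk (num ∷ []) a) (here refl ∷ [])

      module _ (n : Fin (suc (size A))) where
        β′ : A ^ (num ∷ Δ)
        β′ = n ∷ β
        r₌ rE : A ^ ts → A ^ ts → Bool
        r₌ = ⟦_⟧₂ A φ₌ β′
        rE = ⟦_⟧₂ A {ts = ts} false′ β′
        rC : A ^ ts → A ^ nums 1 → Bool
        rC x p = A ⟦ φC ⟧ (++⁺ x (++⁺ p β′))

        isolated : ∀ x y → ¬ T (LRec.edge A ts {1} r₌ rE rC x y)
        isolated x y e = let x′ , y′ , _ , _ , t = to (T-edge A {k = 1} r₌ rE rC) e
                         in ⊨-false A {β = ++⁺ x′ (++⁺ y′ β′)} t

        gen-eq : ∀ {x y} → Gen A r₌ x y ⇔ Gen A (⟦_⟧₂ A S β) x y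
        gen-eq = Gen-cong A λ x y → trans (sub-correct A S _ _)
          (cong (A ⟦ S ⟧_) (trans (eval-lift₂ x y β′ _)
            (cong (λ γ → ++⁺ x (++⁺ y γ)) (trans (eval-wk (n ∷ []) β allVars) (eval-allVars β)))))

        eval-a : eval β′ (wk (num ∷ []) a) ≡ eval β a
        eval-a = eval-wk (n ∷ []) β a

        rC-iff : ∀ x p → T (rC x p) ⇔ x ≡ eval β b
        rC-iff x p = ⊨-eqT A inˡ _ {++⁺ x (++⁺ p β′)} ⨾ mk⇔
          (λ eq → trans (sym (eval-inˡ x _)) (trans eq eval-b))
          (λ eq → trans (eval-inˡ x _) (trans eq (sym eval-b)))
          where
          eval-b : eval (++⁺ x (++⁺ p β′)) (wk ts (wk (nums 1) (wk (num ∷ []) b))) ≡ eval β b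
          eval-b = trans (eval-wk x (++⁺ p β′) (wk (nums 1) (wk (num ∷ []) b)))
            (trans (eval-wk p β′ (wk (num ∷ []) b)) (eval-wk (n ∷ []) β b))

        -- The label formula ignores its number argument: it accepts every number at `b` and none
        -- elsewhere. Hence 0 is a label exactly of the class of `b`.
        label-iff : ∀ {x} → T (LRec.label A ts {1} r₌ rE rC x 0) ⇔ Gen A (⟦_⟧₂ A S β) x (eval β b)
        label-iff {x} = T-label A {k = 1} r₌ rE rC ⨾ mk⇔
          (λ (y , x∼y , p , c , _) → to gen-eq (subst (Gen A r₌ x) (to (rC-iff y p) c) x∼y))
          (λ g → _ , from gen-eq g , Fin.zero ∷ [] , from (rC-iff _ (Fin.zero ∷ [])) refl , refl)

        correct : A ⊨ φ [ β′ ] ⇔ (0 < toℕ n + 0 × Gen A (⟦_⟧₂ A S β) (eval β a) (eval β b))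
        correct = inX-isolated A {k = 1} r₌ rE rC (value A 1 (n ∷ [])) (isolated _) ⨾
          ⇔-id _ ×-⇔ (label-iff ⨾
          mk⇔ (subst (λ x → Gen A _ x _) eval-a) (subst (λ x → Gen A _ x _) (sym eval-a)))

      fw : (∃[ n ] A ⊨ φ [ n ∷ β ]) → Gen A (⟦_⟧₂ A S β) (eval β a) (eval β b)
      fw (n , t) = proj₂ (to (correct n) t)

      bw : Gen A (⟦_⟧₂ A S β) (eval β a) (eval β b) → ∃[ n ] A ⊨ φ [ n ∷ β ]
      -- Any positive budget would do; 1 lies in the number sort because the universe is non-empty.
      bw g = Fin.fromℕ< 1<b , from (correct _)
        (subst (λ m → 0 < m + 0) (sym (Fin.toℕ-fromℕ< 1<b)) (s≤s z≤n) , g)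
        where
        1<b : 1 < base A
        1<b = s≤s (ℕ.>-nonZero⁻¹ (size A))

-- Counting classes: the tuples are tagged by a number, and a root with a
-- non-zero tag has an edge to each class with tag 0 that meets P.  As the
-- root is the only source, these classes keep a positive budget and are all
-- in X, so that the root tests the number of classes against its label.

module _ {τ : Vocabulary} (A : Structure τ) {ts : Ctx} {k : ℕ}
  (r₌ rE : A ^ (num ∷ ts) → A ^ (num ∷ ts) → Bool) (rC : A ^ (num ∷ ts) → A ^ nums k → Bool)
  (s : A ^ ts → A ^ ts → Bool) (P : A ^ ts → Set) (q : A ^ nums k) (w : A ^ (num ∷ ts))
  (w≢0 : ¬ All.head w ≡ Fin.zero)
  (=-iff : ∀ c d → T (r₌ c d) ⇔ (All.head c ≡ All.head d × T (s (All.tail c) (All.tail d))))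
  (E-iff : ∀ c d → T (rE c d) ⇔ (c ≡ w × All.head d ≡ Fin.zero × P (All.tail d)))
  (C-iff : ∀ c p → T (rC c p) ⇔ (All.head c ≡ Fin.zero ⊎ p ≡ q))
  where

  open LRec A (num ∷ ts) {k} r₌ rE rC
  private
    module ∼ = IsEquivalence (Gen-isEquivalence A r₌)
    module ≈ = IsEquivalence (Gen-isEquivalence A s)

    _≈_ : Rel (A ^ ts) 0ℓ
    _≈_ = Gen A s

  -- Generating pairs have equal tags, so a path stays within one tag and is a path of `s` there.
  tagged-∼ : ∀ {c d} → c ∼ d ⇔ (All.head c ≡ All.head d × All.tail c ≈ All.tail d)
  tagged-∼ {c} {d} = mk⇔
    (λ p → Eq.gfold ≡.isEquivalence All.head (λ {x} {y} t → proj₁ (to (=-iff x y) t)) p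
         , Eq.gmap All.tail (λ {x} {y} t → proj₂ (to (=-iff x y) t)) p)
    (bw c d)
    where
    bw : ∀ c d → All.head c ≡ All.head d × All.tail c ≈ All.tail d → c ∼ d
    bw (x ∷ a) (y ∷ b) (refl , p) = Eq.gmap (x ∷_) (λ t → from (=-iff _ _) (refl , t)) p

  star-edge : ∀ {c d} → T (edge c d) ⇔ (c ∼ w × All.head d ≡ Fin.zero × ∃[ b ] (All.tail d ≈ b × P b))
  star-edge {c} {d} = T-edge A r₌ rE rC ⨾ mk⇔
    (λ (c′ , d′ , c∼c′ , d∼d′ , e) →
      let c′≡w , z , p = to (E-iff c′ d′) e
          h , t        = to tagged-∼ d∼d′
      in subst (c ∼_) c′≡w c∼c′ , trans h z , _ , t , p)
    (λ (c∼w , z , b , d≈b , p) → w , Fin.zero ∷ b , c∼w , from tagged-∼ (z , d≈b)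
      , from (E-iff w (Fin.zero ∷ b)) (refl , refl , p))

  -- All edges start in the class of `w`, so dividing by the in-degree passes the remaining budget
  -- on undiminished.
  star-inDegree : ∀ {d} → T (edge w d) → inDegree d ≡ 1
  star-inDegree {d} e = card-≡ (Gen-isEquivalence A r₌) ≡.isEquivalence
    (classes-card A r₌ rE rC (λ c → edge c d)) (below-card 1) (λ c n → c ∼ w × n ≡ 0)
    (λ t → 0 , (proj₁ (to star-edge t) , refl) , s≤s z≤n)
    (λ { {zero} _ → w , (∼.refl , refl) , e ; {suc _} (s≤s ()) })
    (λ (p , n≡0) (p′ , n′≡0) → mk⇔ (λ _ → trans n≡0 (sym n′≡0)) (λ _ → ∼.trans p (∼.sym p′)))

  -- Tag 0 differs from the tag of the root, so there are no outgoing edges; and tag 0 admits every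
  -- number as a label, in particular 0.
  star-leaf : ∀ {d} ℓ → 0 < ℓ → All.head d ≡ Fin.zero → T (inX d ℓ)
  star-leaf {d} ℓ 0<ℓ z = from (inX-isolated A r₌ rE rC ℓ λ _ e →
      w≢0 (trans (sym (proj₁ (to tagged-∼ (proj₁ (to star-edge e))))) z))
    (0<ℓ , from (T-label A r₌ rE rC)
      (let n , n≡0 = value-surjective A k 0 (ℕ.>-nonZero⁻¹ _ {{m^n≢0 (base A) k}})
       in d , ∼.refl , n , from (C-iff d n) (inj₁ z) , n≡0))

  -- The class of the root contains no tuple with tag 0, which leaves `q` as the only source of a
  -- label.
  star-label : ∀ m → T (label w m) ⇔ m ≡ value A k q
  star-label m = T-label A r₌ rE rC ⨾ mk⇔
    (λ (c , w∼c , n , l , v) → Sum.[ (λ z → ⊥-elim (w≢0 (trans (proj₁ (to tagged-∼ w∼c)) z)))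
                                    , (λ n≡q → trans (sym v) (cong (value A k) n≡q)) ] (to (C-iff c n) l))
    (λ v → w , ∼.refl , q , from (C-iff w q) (inj₂ refl) , sym v)

  -- A budget above 1 pays for the step at the root and leaves a positive budget for the leaves.
  -- With every neighbour of the root in X, the number compared with the label is the out-degree
  -- itself.
  star-inX : ∀ {m} ℓ → 1 < ℓ → Card _≈_ P m → T (inX w ℓ) ⇔ m ≡ value A k q
  star-inX {m} (suc ℓ) (s≤s 0<ℓ) card =
    mk⇔ (subst T eq) (subst T (sym eq)) ⨾ star-label m
    where
    reached : ∀ {d} → T (edge w d) → T (inX d (ℓ ÷ inDegree d))
    reached {d} e = star-leaf (ℓ ÷ inDegree d)
      (subst (λ n → 0 < ℓ ÷ n) (sym (star-inDegree e)) (subst (0 <_) (sym (n/1≡n ℓ)) 0<ℓ))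
      (proj₁ (proj₂ (to star-edge e)))

    eq : inX w (suc ℓ) ≡ label w m
    eq = trans (inX-suc w ℓ) (cong (label w) (card-≡ (Gen-isEquivalence A r₌) (Gen-isEquivalence A s)
      (classes-card A r₌ rE rC _) card
      (λ d b → All.head d ≡ Fin.zero × All.tail d ≈ b)
      (λ t → let _ , z , b , d≈b , p = to star-edge (proj₁ (to T-∧ t)) in b , (z , d≈b) , p)
      (λ {b} p → let e = from star-edge (∼.refl , refl , b , ≈.refl , p)
                 in Fin.zero ∷ b , (refl , ≈.refl) , from T-∧ (e , reached e))
      (λ (z , d≈b) (z′ , d′≈b′) → mk⇔
        (λ p → ≈.trans (≈.sym d≈b) (≈.trans (proj₂ (to tagged-∼ p)) d′≈b′))
        (λ p → from tagged-∼ (trans z (sym z′) , ≈.trans d≈b (≈.trans p (≈.sym d′≈b′)))))))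

module _ {τ : Vocabulary} {Δ ts : Ctx} {k : ℕ} (P : Formula τ (ts ++ Δ)) (S : Formula τ (ts ++ ts ++ Δ))
         (q : Vars Δ (nums (suc k))) where
  private
    us = num ∷ ts

    u v w : Vars (us ++ us ++ us ++ Δ) us
    u = inˡ
    v = wk us inˡ
    w = wk us (wk us inˡ)

    params : Vars (us ++ us ++ us ++ Δ) Δ
    params = wk us (wk us (wk us allVars))

    φ₌ φE : Formula τ (us ++ us ++ us ++ Δ)
    φ₌ = equal (All.head u) (All.head v) ∧′ sub S (++⁺ (All.tail u) (++⁺ (All.tail v) params))
    φE = eqT u w ∧′ isZero (All.head v) ∧′ sub P (++⁺ (All.tail v) params)

    φC : Formula τ (us ++ nums (suc k) ++ us ++ Δ)
    φC = isZero (All.head {P = _∈ us ++ nums (suc k) ++ us ++ Δ} (inˡ {us}))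
           ∨′ eqT (wk us inˡ) (wk us (wk (nums (suc k)) (wk us q)))

    -- The budget has the tag of the root as both of its digits, so a non-zero tag makes it at least
    -- 2. One digit would not do: over a one-element universe it cannot exceed 1.
    star : Formula τ (us ++ Δ)
    star = lrec us {k} {1} φ₌ φE φC inˡ (here refl ∷ here refl ∷ [])

  opaque
    -- No element of A can be named, so the root is quantified; every tuple with a non-zero tag
    -- serves equally well.
    classCount : Formula τ Δ
    classCount = ∃* us (¬′ isZero (here refl) ∧′ star)

  module _ (A : Structure τ) (β : A ^ Δ) where
    private
      module _ (c : A ^ us) where
        β′ : A ^ (us ++ Δ)
        β′ = ++⁺ c β

        eval-params : ∀ (a b : A ^ us) → eval (++⁺ a (++⁺ b β′)) params ≡ β
        eval-params a b = trans (eval-wk a (++⁺ b β′) (wk us (wk us allVars)))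
          (trans (eval-wk b β′ (wk us allVars)) (trans (eval-wk c β allVars) (eval-allVars β)))

        eval-v : ∀ (a b : A ^ us) → eval (++⁺ a (++⁺ b β′)) v ≡ b
        eval-v a b = trans (eval-wk a (++⁺ b β′) inˡ) (eval-inˡ b β′)

        eval-w : ∀ (a b : A ^ us) → eval (++⁺ a (++⁺ b β′)) w ≡ c
        eval-w a b = trans (eval-wk a (++⁺ b β′) (wk us inˡ)) (trans (eval-wk b β′ inˡ) (eval-inˡ c β))

        =-iff : ∀ (a b : A ^ us) → T (⟦_⟧₂ A φ₌ β′ a b) ⇔
                (All.head a ≡ All.head b × T (⟦_⟧₂ A S β (All.tail a) (All.tail b)))
        =-iff a b = T-∧ ⨾
          (⊨-equal A {x = All.head u} {All.head v} {γ} ⨾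
           mk⇔ (subst₂ _≡_ ua vb) (subst₂ _≡_ (sym ua) (sym vb)))
          ×-⇔ (⊨-sub A S _ γ ⨾ mk⇔ (subst (A ⊨ S [_]) eq) (subst (A ⊨ S [_]) (sym eq)))
          where
          γ : A ^ (us ++ us ++ us ++ Δ)
          γ = ++⁺ a (++⁺ b β′)
          ua = cong All.head (eval-inˡ a (++⁺ b β′))
          vb = cong All.head (eval-v a b)
          eq : eval γ (++⁺ (All.tail u) (++⁺ (All.tail v) params)) ≡ ++⁺ (All.tail a) (++⁺ (All.tail b) β)
          eq = trans (map-++⁺ (All.tail u) (++⁺ (All.tail v) params)) (cong₂ ++⁺ (cong All.tail (eval-inˡ a (++⁺ b β′)))
            (trans (map-++⁺ (All.tail v) params) (cong₂ ++⁺ (cong All.tail (eval-v a b)) (eval-params a b))))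

        E-iff : ∀ (a b : A ^ us) → T (⟦_⟧₂ A φE β′ a b) ⇔
                (a ≡ c × All.head b ≡ Fin.zero × A ⊨ P [ ++⁺ (All.tail b) β ])
        E-iff a b = T-∧ ⨾
          (⊨-eqT A u w {γ} ⨾ mk⇔ (subst₂ _≡_ (eval-inˡ a (++⁺ b β′)) (eval-w a b))
                                (subst₂ _≡_ (sym (eval-inˡ a (++⁺ b β′))) (sym (eval-w a b))))
          ×-⇔ (T-∧ ⨾
          (⊨-isZero A (All.head v) {γ} ⨾ mk⇔ (trans (sym vb)) (trans vb))
          ×-⇔ (⊨-sub A P _ γ ⨾ mk⇔ (subst (A ⊨ P [_]) eq) (subst (A ⊨ P [_]) (sym eq))))
          where
          γ : A ^ (us ++ us ++ us ++ Δ)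
          γ = ++⁺ a (++⁺ b β′)
          vb = cong All.head (eval-v a b)
          eq : eval γ (++⁺ (All.tail v) params) ≡ ++⁺ (All.tail b) β
          eq = trans (map-++⁺ (All.tail v) params) (cong₂ ++⁺ (cong All.tail (eval-v a b)) (eval-params a b))

        C-iff : ∀ (a : A ^ us) (p : A ^ nums (suc k)) → T (A ⟦ φC ⟧ ++⁺ a (++⁺ p β′)) ⇔ (All.head a ≡ Fin.zero ⊎ p ≡ eval β q)
        C-iff a p = T-∨ ⨾
          (⊨-isZero A (here refl) {γ} ⨾ mk⇔ (trans (sym ua)) (trans ua))
          ⊎-⇔ (⊨-eqT A (wk us inˡ) _ {γ} ⨾ mk⇔ (subst₂ _≡_ p₁ p₂) (subst₂ _≡_ (sym p₁) (sym p₂)))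
          where
          γ : A ^ (us ++ nums (suc k) ++ us ++ Δ)
          γ = ++⁺ a (++⁺ p β′)
          ua = cong All.head (eval-inˡ a (++⁺ p β′))
          p₁ = trans (eval-wk a (++⁺ p β′) inˡ) (eval-inˡ p β′)
          p₂ = trans (eval-wk a (++⁺ p β′) (wk (nums (suc k)) (wk us q))) (trans (eval-wk p β′ (wk us q)) (eval-wk c β q))

        budget : ¬ All.head c ≡ Fin.zero → 1 < value A 2 (All.head c ∷ All.head c ∷ [])
        budget c≢0 = +-mono-≤ 0<x (≤-trans 0<x (≤-trans (m≤m+n x 0) (m≤m*n (x + 0) (base A))))
          where
          x = toℕ (All.head c)
          0<x : 0 < x
          0<x = n≢0⇒n>0 (λ x≡0 → c≢0 (Fin.toℕ-injective x≡0))

        star-correct : ∀ {m} → ¬ All.head c ≡ Fin.zero →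
          Card (Gen A (⟦_⟧₂ A S β)) (λ a → A ⊨ P [ ++⁺ a β ]) m →
          A ⊨ star [ β′ ] ⇔ m ≡ value A (suc k) (eval β q)
        star-correct {m} c≢0 card = mk⇔ (subst₂ inX (eval-inˡ c β) r-eq) (subst₂ inX (sym (eval-inˡ c β)) (sym r-eq))
          ⨾ star-inX A (⟦_⟧₂ A φ₌ β′) (⟦_⟧₂ A φE β′) (λ a p → A ⟦ φC ⟧ ++⁺ a (++⁺ p β′)) (⟦_⟧₂ A S β)
            (λ a → A ⊨ P [ ++⁺ a β ]) (eval β q) c c≢0 =-iff E-iff C-iff
            (value A 2 (All.head c ∷ All.head c ∷ [])) (budget c≢0) card
          where
          inX : A ^ us → ℕ → Set
          inX a ℓ = T (LRec.inX A us {suc k} (⟦_⟧₂ A φ₌ β′) (⟦_⟧₂ A φE β′) (λ a p → A ⟦ φC ⟧ ++⁺ a (++⁺ p β′)) a ℓ)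
          r-eq : value A 2 (eval β′ (here refl ∷ here refl ∷ [])) ≡ value A 2 (All.head c ∷ All.head c ∷ [])
          r-eq = cong (λ x → value A 2 (x ∷ x ∷ [])) (cong All.head (eval-inˡ c β))

    opaque
      unfolding classCount

      ⊨-classCount : ∀ {m} → Card (Gen A (⟦_⟧₂ A S β)) (λ a → A ⊨ P [ ++⁺ a β ]) m →
                     A ⊨ classCount [ β ] ⇔ m ≡ value A (suc k) (eval β q)
      ⊨-classCount {m} card = ⊨-∃* A us ⨾ mk⇔
        (λ (c , t) → let c≢0 , t′ = to (body c) t in to (star-correct c c≢0 card) t′)
        (λ eq → root , from (body root) (root≢0 , from (star-correct root root≢0 card) eq))
        where
        body : ∀ c → A ⊨ ¬′ isZero (here refl) ∧′ star [ ++⁺ c β ] ⇔ ((¬ All.head c ≡ Fin.zero) × A ⊨ star [ ++⁺ c β ])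
        body c = T-∧ ⨾ (T-not ⨾ ¬-cong-⇔ (⊨-isZero A (here refl) {++⁺ c β} ⨾
          mk⇔ (trans (sym (cong All.head (eval-inˡ c β)))) (trans (cong All.head (eval-inˡ c β))))) ×-⇔ ⇔-id _

        1<b : 1 < base A
        1<b = s≤s (ℕ.>-nonZero⁻¹ (size A))

        root : A ^ us
        -- Only the tag matters; the other entries are arbitrary.
        root = Fin.fromℕ< 1<b ∷ All.universal (element A) ts

        root≢0 : ¬ Fin.fromℕ< 1<b ≡ Fin.zero
        root≢0 eq with trans (sym (Fin.toℕ-fromℕ< 1<b)) (cong toℕ eq)
        ... | ()

-- Pulling a recursion graph back along a representation

module QuotientSimulation {τ σ : Vocabulary} (A : Structure τ) (B : Structure σ) {ts us : Ctx} {k j : ℕ}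
  (r₌ rE : A ^ ts → A ^ ts → Bool) (rC : A ^ ts → A ^ nums k → Bool)
  (s₌ sE : B ^ us → B ^ us → Bool) (sC : B ^ us → B ^ nums j → Bool)
  (_⊳_ : A ^ ts → B ^ us → Set) (_≈_ : A ^ ts → A ^ ts → Set)
  (total : ∀ c → ∃ λ a → a ⊳ c)
  (⊳-≈   : ∀ {a b c} → a ⊳ c → a ≈ b ⇔ b ⊳ c)
  (≈-sym : ∀ {a b} → a ≈ b → b ≈ a)
  (⊳-functional : ∀ {a c d} → a ⊳ c → a ⊳ d → c ≡ d)
  (=-iff : ∀ a b → T (r₌ a b) ⇔ (a ≈ b ⊎ (∃[ c ] ∃[ d ] (a ⊳ c × b ⊳ d × T (s₌ c d)))))
  (E-iff : ∀ a b → T (rE a b) ⇔ (∃[ c ] ∃[ d ] (a ⊳ c × b ⊳ d × T (sE c d))))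
  (C-iff : ∀ {a c} → a ⊳ c → ∀ m →
           (∃[ n ] (T (rC a n) × value A k n ≡ m)) ⇔ (∃[ n ] (T (sC c n) × value B j n ≡ m)))
  where

  private
    module N∼ = IsEquivalence (Gen-isEquivalence B s₌)

  -- A path that starts at a represented tuple stays among represented tuples: a `≈` step keeps the
  -- represented vertex, and any other step is one of `s₌`, whose starting point is the current
  -- vertex by functionality.
  follow : ∀ {a b c} → a ⊳ c → Gen A r₌ a b → ∃ λ d → b ⊳ d × Gen B s₌ c d
  follow p ε = _ , p , ε
  follow {a} p (_◅_ {j = b} (fwd t) g) with to (=-iff a b) t
  ... | inj₁ a≈b = follow (to (⊳-≈ p) a≈b) g
  ... | inj₂ (c′ , d , p′ , q , s) with ⊳-functional p p′
  ... | refl with follow q g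
  ... | e , r , h = e , r , fwd s ◅ h
  follow {a} p (_◅_ {j = b} (bwd t) g) with to (=-iff b a) t
  ... | inj₁ b≈a = follow (to (⊳-≈ p) (≈-sym b≈a)) g
  ... | inj₂ (d , c′ , q , p′ , s) with ⊳-functional p p′
  ... | refl with follow q g
  ... | e , r , h = e , r , bwd s ◅ h

  lift-∼ : ∀ {a b c d} → a ⊳ c → b ⊳ d → Gen B s₌ c d → Gen A r₌ a b
  -- Even the empty path lifts to a step, since `a` and `b` may be different representatives of one
  -- vertex.
  lift-∼ {a} {b} p q ε = Eq.return (from (=-iff a b) (inj₁ (from (⊳-≈ p) q)))
  lift-∼ {a} p q (_◅_ {j = e} (fwd s) g) =
    let b , r = total e in fwd (from (=-iff a b) (inj₂ (_ , e , p , r , s))) ◅ lift-∼ r q g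
  lift-∼ {a} p q (_◅_ {j = e} (bwd s) g) =
    let b , r = total e in bwd (from (=-iff b a) (inj₂ (e , _ , r , p , s))) ◅ lift-∼ r q g

  inX-quotient : ∀ ℓ {a c} → a ⊳ c → LRec.inX A ts {k} r₌ rE rC a ℓ ≡ LRec.inX B us {j} s₌ sE sC c ℓ
  inX-quotient = Simulation.inX-sim A B _⊳_ total
    (λ p g → let d , q , _ = follow p g in d , q)
    (λ p q → mk⇔ (λ g → let d , q′ , h = follow p g in subst (Gen B s₌ _) (⊳-functional q′ q) h) (lift-∼ p q))
    (λ {a} {b} t → let c , d , p , q , _ = to (E-iff a b) t in (c , p) , (d , q))
    (λ {a} {_} {b} p q → mk⇔
      (λ t → let c , d , p′ , q′ , s = to (E-iff a b) t
             in subst₂ (λ x y → T (sE x y)) (⊳-functional p′ p) (⊳-functional q′ q) s)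
      (λ s → from (E-iff a b) (_ , _ , p , q , s)))
    C-iff

-- Tuples of tuples

unflatten : ∀ {P : Sort → Set} {ts} n → All P (copies n ts) → Vec (All P ts) n
unflatten           zero    []  = []
unflatten {ts = ts} (suc n) ps = ++⁻ˡ ts ps ∷ unflatten n (++⁻ʳ ts ps)

flatten-unflatten : ∀ {τ} {A : Structure τ} {ts} n (a : A ^ copies n ts) →
                    flatten (unflatten n a) ≡ a
flatten-unflatten           zero    [] = refl
flatten-unflatten {ts = ts} (suc n) a  =
  trans (cong (++⁺ (++⁻ˡ ts a)) (flatten-unflatten n _)) (++⁺-++⁻ ts a)

unflatten-flatten : ∀ {τ} {A : Structure τ} {ts n} (as : Vec (A ^ ts) n) →
                    unflatten n (flatten as) ≡ as
unflatten-flatten []       = refl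
unflatten-flatten {n = suc n} (a ∷ as) = cong₂ _∷_ (++⁻ˡ-++⁺ a (flatten as))
  (trans (cong (unflatten n) (++⁻ʳ-++⁺ a (flatten as))) (unflatten-flatten as))

map-unflatten : ∀ {P Q : Sort → Set} {f : ∀ {s} → P s → Q s} {ts} n
                (ps : All P (copies n ts)) → Vec.map (All.map f) (unflatten n ps) ≡ unflatten n (All.map f ps)
map-unflatten           zero    [] = refl
map-unflatten {ts = ts} (suc n) ps = cong₂ _∷_ (map-++⁻ˡ ts ps)
  (trans (map-unflatten n _) (cong (unflatten n) (map-++⁻ʳ ts ps)))

-- The translation

module _ {τ₁ τ₂ : Vocabulary} (Θ : Transduction τ₁ τ₂) where

  -- One digit more than the arity, because |V(Θ[A])| can be (|V(A)|+1)^arity.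
  width : ℕ
  width = suc (arity Θ)

  tr : Sort → Ctx
  tr str = sorts Θ
  tr num = nums width

  trs : Ctx → Ctx
  trs []       = []
  trs (s ∷ ts) = tr s ++ trs ts

  -- Says which variables of Δ stand for each variable of Γ. As Δ is otherwise arbitrary, auxiliary
  -- quantifiers can be inserted anywhere in a translation.
  Env : Ctx → Ctx → Set
  Env Δ Γ = All (λ s → Vars Δ (tr s)) Γ

  wkE : ∀ us {Δ Γ} → Env Δ Γ → Env (us ++ Δ) Γ
  wkE us = All.map (wk us)

  split : ∀ {P : Sort → Set} Γ → All P (trs Γ) → All (λ s → All P (tr s)) Γ
  split []      []  = []
  split (s ∷ Γ) ps = ++⁻ˡ (tr s) ps ∷ split Γ (++⁻ʳ (tr s) ps)

  join : ∀ {P : Sort → Set} {Γ} → All (λ s → All P (tr s)) Γ → All P (trs Γ)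
  join []       = []
  join (p ∷ ps) = ++⁺ p (join ps)

  liftE : ∀ ts {Δ Γ} → Env Δ Γ → Env (trs ts ++ Δ) (ts ++ Γ)
  liftE ts e = ++⁺ (split ts inˡ) (wkE (trs ts) e)

  opaque
    θ≈-lifted : ∀ {Δ} → Formula τ₁ (sorts Θ ++ sorts Θ ++ Δ)
    θ≈-lifted = sub (θ≈ Θ) (++⁺ (inˡ {sorts Θ}) (wk (sorts Θ) (inˡ {sorts Θ})))

    approx : ∀ {Δ} → Vars Δ (sorts Θ) → Vars Δ (sorts Θ) → Formula τ₁ Δ
    approx = gen θ≈-lifted

    -- Only the class of `x` has to meet `θV`, not `x` itself. For numbers, the size of Θ[A] is
    -- guessed as a numeral because `classCount` can only confirm a given value.
    valid : ∀ {Δ} s → Vars Δ (tr s) → Formula τ₁ Δ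
    valid str x = ∃* (sorts Θ) (sub (θV Θ) inˡ ∧′ approx (wk (sorts Θ) x) inˡ)
    valid num q = ∃* (nums width)
      (classCount {k = arity Θ} (sub (θV Θ) inˡ) θ≈-lifted inˡ ∧′ ¬′ ltT width inˡ (wk (nums width) q))

    same : ∀ {Δ} s → Vars Δ (tr s) → Vars Δ (tr s) → Formula τ₁ Δ
    same str = approx
    same num = eqT

    validE : ∀ {Δ Γ} → Env Δ Γ → Formula τ₁ Δ
    validE {Γ = []}    []      = true′
    validE {Γ = s ∷ Γ} (x ∷ e) = valid s x ∧′ validE e

    sameE : ∀ {Δ Γ} → Env Δ Γ → Env Δ Γ → Formula τ₁ Δ
    sameE {Γ = []}    []      []      = true′
    sameE {Γ = s ∷ Γ} (x ∷ e) (y ∷ f) = same s x y ∧′ sameE e f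

    sameT : ∀ {Δ} ts → Formula τ₁ (trs ts ++ trs ts ++ Δ)
    sameT ts = sameE (split ts inˡ) (split ts (wk (trs ts) inˡ))

    -- Numerals of Θ[A] appear on two levels: digits in base |V(Θ[A])|+1, each of which is a block
    -- of digits in base |V(A)|+1.
    ltE : ∀ {Δ} k → Env Δ (nums k) → Env Δ (nums k) → Formula τ₁ Δ
    ltE zero    []      []      = false′
    ltE (suc k) (p ∷ e) (q ∷ f) = ltE k e f ∨′ (sameE e f ∧′ ltT width p q)

  -- Enough digits in base |V(A)|+1 for k digits in base |V(Θ[A])|+1.
  long : ℕ → ℕ
  long k = suc (width * k)

  opaque
    -- ⟨p̄⟩ in Θ[A] is the number of valid k-tuples below p̄, which converts it
    -- to base |V(A)|+1 without arithmetic.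
    encodes : ∀ {Δ} k → Env Δ (nums k) → Vars Δ (nums (long k)) → Formula τ₁ Δ
    encodes k p q = classCount {k = width * k}
      (validE (split (nums k) inˡ) ∧′ ltE k (split (nums k) inˡ) (wkE (trs (nums k)) p))
      (sameT (nums k)) q

  opaque
    -- `θR` need not be invariant under ≈ and is consulted only at tuples satisfying `θV`. Hence it
    -- is tested at fresh members `bs` of the given classes rather than at `cs`.
    matches : ∀ {Δ n} → Vec (Vars Δ (sorts Θ)) n → Vec (Vars Δ (sorts Θ)) n → Formula τ₁ Δ
    matches []       []       = true′
    matches (b ∷ bs) (c ∷ cs) = (sub (θV Θ) b ∧′ approx b c) ∧′ matches bs cs

    both : ∀ {Δ} ts → Formula τ₁ (trs ts ++ trs ts ++ Δ) → Formula τ₁ (trs ts ++ trs ts ++ Δ)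
    both ts φ = validE (split ts inˡ) ∧′ validE (split ts (wk (trs ts) inˡ)) ∧′ φ

  translate : ∀ {Γ Δ} → Formula τ₂ Γ → Env Δ Γ → Formula τ₁ Δ
  translate (equal {s} x y) e = same s (All.lookup e x) (All.lookup e y)
  translate (rel R xs) e = let cs = copies (ar τ₂ R) (sorts Θ) in ∃* cs
    (matches (unflatten (ar τ₂ R) inˡ) (Vec.map (λ x → wk cs (All.lookup e x)) xs) ∧′ sub (θR Θ R) inˡ)
  translate (leq p q) e = ¬′ ltT width (All.lookup e q) (All.lookup e p)
  translate (¬′ φ)    e = ¬′ translate φ e
  translate (φ ∧′ ψ)  e = translate φ e ∧′ translate ψ e
  translate (φ ∨′ ψ)  e = translate φ e ∨′ translate ψ e
  translate (∃′ s φ)  e = ∃* (tr s) (valid s inˡ ∧′ translate φ (inˡ ∷ wkE (tr s) e))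
  translate (∀′ s φ)  e = ¬′ ∃* (tr s) (valid s inˡ ∧′ ¬′ translate φ (inˡ ∷ wkE (tr s) e))
  translate (count ts {k} ψ p) e = ∃* (nums (long k))
    -- The quantified numeral is the common value of both sides: first the prescribed number,
    -- converted to base |V(A)|+1, then the count itself.
    (encodes k (All.map (All.lookup e′) p) inˡ ∧′
     classCount {k = width * k} (validE (split ts inˡ) ∧′ translate ψ (liftE ts e′)) (sameT ts) inˡ)
    where e′ = wkE (nums (long k)) e
  translate (lrec ts {k} {j} φ₌ φE φC w r) e = ∃* (nums (long (suc j)))
    (encodes (suc j) (All.map (All.lookup e′) r) inˡ ∧′
     lrec (trs ts) {width * suc k} {width * suc j}
       -- `sameT` merges the representatives of one vertex; `both` lets `φ₌` act on valid tuples
       -- only, so no class mixes valid and invalid tuples.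
       (sameT ts ∨′ both ts (translate φ₌ (liftE ts (liftE ts e′))))
       (both ts (translate φE (liftE ts (liftE ts e′))))
       -- A label matters only as a number, so `φC` is asked about a numeral of Θ[A] with the same
       -- value as the given numeral over A.
       (∃* ns (validE (split (nums (suc k)) inˡ) ∧′
               -- `φC` expects the vertex before the numeral, whereas the numeral is bound
               -- innermost; the environment is therefore assembled by hand.
               translate φC (++⁺ (wkE ns (split ts inˡ)) (++⁺ (split (nums (suc k)) inˡ)
                 (wkE ns (wkE (trs ts) (wkE (nums (long (suc k))) e′))))) ∧′
               encodes (suc k) (split (nums (suc k)) inˡ) (wk ns (wk (trs ts) inˡ))))
       (join (All.map (All.lookup e′) w)) inˡ)
    where
    e′ = wkE (nums (long (suc j))) e
    ns = trs (nums (suc k))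

-- Correctness of the translation

module _ {τ₁ τ₂ : Vocabulary} (Θ : Transduction τ₁ τ₂) where

  split-join : ∀ {P : Sort → Set} {Γ} (ps : All (λ s → All P (tr Θ s)) Γ) → split Θ Γ (join Θ ps) ≡ ps
  split-join []       = refl
  split-join {Γ = s ∷ Γ} (p ∷ ps) = cong₂ _∷_ (++⁻ˡ-++⁺ p (join Θ ps))
    (trans (cong (split Θ Γ) (++⁻ʳ-++⁺ p (join Θ ps))) (split-join ps))

  map-split : ∀ {P Q : Sort → Set} {f : ∀ {s} → P s → Q s} Γ (ps : All P (trs Θ Γ)) →
              All.map (All.map f) (split Θ Γ ps) ≡ split Θ Γ (All.map f ps)
  map-split []      []  = refl
  map-split (s ∷ Γ) ps = cong₂ _∷_ (map-++⁻ˡ (tr Θ s) ps)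
    (trans (map-split Γ _) (cong (split Θ Γ) (map-++⁻ʳ (tr Θ s) ps)))

-- Representing elements, numbers and assignments of Θ[A]

module Representation {τ₁ τ₂ : Vocabulary} (Θ : Transduction τ₁ τ₂) (A : Structure τ₁) (d : Defined Θ A) where

  B : Structure τ₂
  B = transduce Θ A d

  K : ℕ
  K = width Θ

  _≈_ : Rel (A ^ sorts Θ) 0ℓ
  _≈_ = _≈Θ_ Θ A

  θ≈ᵇ : A ^ sorts Θ → A ^ sorts Θ → Bool
  θ≈ᵇ a b = A ⟦ θ≈ Θ ⟧ ++⁺ a b

  module ≈ = IsEquivalence (Gen-isEquivalence A θ≈ᵇ)

  classes-Θ : Card _≈_ (λ a → A ⊨ θV Θ [ a ]) (size B)
  classes-Θ = dedup-card (tuples-complete A) (Gen-isEquivalence A θ≈ᵇ) (_≈Θ?_ Θ A) (λ a → A ⟦ θV Θ ⟧ a)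

  size-bound : base B ≤ base A ℕ.^ K
  size-bound = begin-strict
    size B                           ≤⟨ length-deduplicate (_≈Θ?_ Θ A) (domain Θ A) ⟩
    length (domain Θ A)              ≤⟨ length-filter (λ a → T? (A ⟦ θV Θ ⟧ a)) (tuples A (sorts Θ)) ⟩
    length (tuples A (sorts Θ))      ≤⟨ tuples-length A (sorts Θ) ⟩
    -- Strict because the base is at least 2. The strictness makes room for the number `size B`
    -- itself, which belongs to the number sort of Θ[A].
    base A ℕ.^ arity Θ               <⟨ ^-monoʳ-< (base A) (s≤s (ℕ.>-nonZero⁻¹ (size A))) {arity Θ} ≤-refl ⟩
    base A ℕ.^ K                     ∎
    where open ≤-Reasoning

  Rep : ∀ s → A ^ tr Θ s → Dom B s → Set
  Rep str a c = _/≈≡_ Θ A a c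
  Rep num a m = value A K a ≡ toℕ m

  -- Unlike `Rep` this is meaningful for tuples that represent nothing; on the others, being similar
  -- is the same as representing the same element.
  Sim : ∀ s → Rel (A ^ tr Θ s) 0ℓ
  Sim str = _≈_
  Sim num = _≡_

  Sim-sym : ∀ s {a b} → Sim s a b → Sim s b a
  Sim-sym str = ≈.sym
  Sim-sym num = sym

  Rep-total : ∀ s c → ∃ λ a → Rep s a c
  Rep-total str c = lookup (representatives Θ A) c , ≈.refl
  Rep-total num m = value-surjective A K (toℕ m) (<-≤-trans (Fin.toℕ<n m) size-bound)

  Rep-Sim : ∀ s {a b c} → Rep s a c → Sim s a b ⇔ Rep s b c
  Rep-Sim str p = mk⇔ (λ q → ≈.trans (≈.sym q) p) (λ q → ≈.trans p (≈.sym q))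
  Rep-Sim num p = mk⇔ (λ { refl → p }) (λ q → value-injective A K (trans p (sym q)))

  Rep-functional : ∀ s {a c d} → Rep s a c → Rep s a d → c ≡ d
  Rep-functional str p q = distinct classes-Θ _ _ (≈.trans (≈.sym p) q)
  Rep-functional num p q = Fin.toℕ-injective (trans (sym p) q)

  infixr 5 _∷_
  data Reps : ∀ {Γ} → All (λ s → A ^ tr Θ s) Γ → B ^ Γ → Set where
    []  : Reps [] []
    _∷_ : ∀ {s Γ a c} {as : All (λ s → A ^ tr Θ s) Γ} {cs} → Rep s a c → Reps as cs →
          Reps {s ∷ Γ} (a ∷ as) (c ∷ cs)

  data Sims : ∀ {Γ} → Rel (All (λ s → A ^ tr Θ s) Γ) 0ℓ where
    []  : Sims [] []
    _∷_ : ∀ {s Γ a b} {as bs : All (λ s → A ^ tr Θ s) Γ} → Sim s a b → Sims as bs →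
          Sims {s ∷ Γ} (a ∷ as) (b ∷ bs)

  Sims-refl : ∀ {Γ} {as : All (λ s → A ^ tr Θ s) Γ} → Sims as as
  Sims-refl {as = []}     = []
  Sims-refl {str ∷ _} {as = a ∷ as} = ≈.refl ∷ Sims-refl
  Sims-refl {num ∷ _} {as = a ∷ as} = refl ∷ Sims-refl

  Sims-sym : ∀ {Γ} {as bs : All (λ s → A ^ tr Θ s) Γ} → Sims as bs → Sims bs as
  Sims-sym []           = []
  Sims-sym (_∷_ {s} p ps) = Sim-sym s p ∷ Sims-sym ps

  Sims-trans : ∀ {Γ} {as bs cs : All (λ s → A ^ tr Θ s) Γ} → Sims as bs → Sims bs cs → Sims as cs
  Sims-trans []                 []       = []
  Sims-trans {str ∷ _} (p ∷ ps) (q ∷ qs) = ≈.trans p q ∷ Sims-trans ps qs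
  Sims-trans {num ∷ _} (p ∷ ps) (q ∷ qs) = trans p q ∷ Sims-trans ps qs

  Sims-isEquivalence : ∀ {Γ} → IsEquivalence (Sims {Γ})
  Sims-isEquivalence = record { refl = Sims-refl ; sym = Sims-sym ; trans = Sims-trans }

  Reps-total : ∀ {Γ} (c : B ^ Γ) → ∃ λ a → Reps (split Θ Γ a) c
  Reps-total c = let as , r = go c in join Θ as , subst (λ x → Reps x c) (sym (split-join Θ as)) r
    where
    go : ∀ {Γ} (c : B ^ Γ) → ∃ λ as → Reps as c
    go []            = [] , []
    go (_∷_ {s} c cs) = let a , r = Rep-total s c ; as , rs = go cs in a ∷ as , r ∷ rs

  Reps-Sims : ∀ {Γ} {as bs : All (λ s → A ^ tr Θ s) Γ} {cs} → Reps as cs → Sims as bs ⇔ Reps bs cs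
  Reps-Sims r = mk⇔ (fw r) (bw r)
    where
    fw : ∀ {Γ} {as bs : All (λ s → A ^ tr Θ s) Γ} {cs} → Reps as cs → Sims as bs → Reps bs cs
    fw []             []       = []
    fw (_∷_ {s} r rs) (p ∷ ps) = to (Rep-Sim s r) p ∷ fw rs ps
    bw : ∀ {Γ} {as bs : All (λ s → A ^ tr Θ s) Γ} {cs} → Reps as cs → Reps bs cs → Sims as bs
    bw []             []       = []
    bw (_∷_ {s} r rs) (p ∷ ps) = from (Rep-Sim s r) p ∷ bw rs ps

  Reps-functional : ∀ {Γ} {as : All (λ s → A ^ tr Θ s) Γ} {cs ds} → Reps as cs → Reps as ds → cs ≡ ds
  Reps-functional []             []       = refl
  Reps-functional (_∷_ {s} r rs) (q ∷ qs) = cong₂ _∷_ (Rep-functional s r q) (Reps-functional rs qs)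

  Sims-≡ : ∀ {Γ} {as bs : All (λ s → A ^ tr Θ s) Γ} {cs ds} → Reps as cs → Reps bs ds → Sims as bs ⇔ cs ≡ ds
  Sims-≡ r r′ = mk⇔ (λ p → Reps-functional (to (Reps-Sims r) p) r′) (λ { refl → from (Reps-Sims r) r′ })

  Reps-lookup : ∀ {Γ s} {as : All (λ s → A ^ tr Θ s) Γ} {cs} → Reps as cs → (x : s ∈ Γ) →
                Rep s (All.lookup as x) (All.lookup cs x)
  Reps-lookup (r ∷ rs) (here refl) = r
  Reps-lookup (r ∷ rs) (there x)   = Reps-lookup rs x

  Reps-select : ∀ {Γ ts} {as : All (λ s → A ^ tr Θ s) Γ} {cs} → Reps as cs → (w : Vars Γ ts) →
                Reps (All.map (All.lookup as) w) (eval cs w)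
  Reps-select r []      = []
  Reps-select r (x ∷ w) = Reps-lookup r x ∷ Reps-select r w

  Reps-++ : ∀ {Γ Δ} {as : All (λ s → A ^ tr Θ s) Γ} {bs : All (λ s → A ^ tr Θ s) Δ} {cs ds} →
            Reps as cs → Reps bs ds → Reps (++⁺ as bs) (++⁺ cs ds)
  Reps-++ []       q = q
  Reps-++ (r ∷ rs) q = r ∷ Reps-++ rs q

  evalE : ∀ {Δ Γ} → A ^ Δ → Env Θ Δ Γ → All (λ s → A ^ tr Θ s) Γ
  evalE β = All.map (eval β)

  evalE-inˡ : ∀ {Δ} ts (a : A ^ trs Θ ts) (β : A ^ Δ) → evalE (++⁺ a β) (split Θ ts inˡ) ≡ split Θ ts a
  evalE-inˡ ts a β = trans (map-split Θ ts inˡ) (cong (split Θ ts) (eval-inˡ a β))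

  evalE-wk : ∀ {ts Δ Γ} (a : A ^ ts) (β : A ^ Δ) (e : Env Θ Δ Γ) → evalE (++⁺ a β) (wkE Θ ts e) ≡ evalE β e
  evalE-wk a β e = trans (map-∘ e) (map-cong e (eval-wk a β))

  evalE-second : ∀ {us Δ} ts (a : A ^ us) (b : A ^ trs Θ ts) (β : A ^ Δ) →
                 evalE (++⁺ a (++⁺ b β)) (split Θ ts (wk us inˡ)) ≡ split Θ ts b
  evalE-second {us} ts a b β = trans (map-split Θ ts (wk us inˡ))
    (cong (split Θ ts) (trans (eval-wk a (++⁺ b β) inˡ) (eval-inˡ b β)))

  Represents : ∀ {Δ Γ} → A ^ Δ → Env Θ Δ Γ → B ^ Γ → Set
  Represents β e α = Reps (evalE β e) α

  represents-lookup : ∀ {Δ Γ s} (β : A ^ Δ) (e : Env Θ Δ Γ) {α} → Represents β e α → (x : s ∈ Γ) →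
                      Rep s (eval β (All.lookup e x)) (All.lookup α x)
  represents-lookup {s = s} β e {α} r x =
    subst (λ a → Rep s a (All.lookup α x)) (lookup-map e x) (Reps-lookup r x)

  represents-select : ∀ {Δ Γ ts} (β : A ^ Δ) (e : Env Θ Δ Γ) {α} → Represents β e α → (w : Vars Γ ts) →
                      Represents β (All.map (All.lookup e) w) (eval α w)
  represents-select β e {α} r w = subst (λ as → Reps as (eval α w))
    (trans (map-cong w (λ x → lookup-map e x)) (sym (map-∘ w))) (Reps-select r w)

  represents-wk : ∀ {ts Δ Γ} (a : A ^ ts) (β : A ^ Δ) (e : Env Θ Δ Γ) {α} → Represents β e α →
                  Represents (++⁺ a β) (wkE Θ ts e) α
  represents-wk a β e {α} r = subst (λ as → Reps as α) (sym (evalE-wk a β e)) r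

  represents-inˡ : ∀ ts {Δ} (a : A ^ trs Θ ts) (β : A ^ Δ) {c} → Reps (split Θ ts a) c ⇔
                   Represents (++⁺ a β) (split Θ ts inˡ) c
  represents-inˡ ts a β {c} = mk⇔ (subst (λ as → Reps as c) (sym (evalE-inˡ ts a β)))
                                  (subst (λ as → Reps as c) (evalE-inˡ ts a β))

  represents-++ : ∀ {Δ Γ Γ′} (β : A ^ Δ) (e : Env Θ Δ Γ) (f : Env Θ Δ Γ′) {α γ} →
                  Represents β e α → Represents β f γ → Represents β (++⁺ e f) (++⁺ α γ)
  represents-++ β e f {α} {γ} r q =
    subst (λ as → Reps as (++⁺ α γ)) (sym (map-++⁺ e f)) (Reps-++ r q)

  represents-lift : ∀ ts {Δ Γ} (a : A ^ trs Θ ts) (β : A ^ Δ) (e : Env Θ Δ Γ) {c α} →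
                    Reps (split Θ ts a) c → Represents β e α →
                    Represents (++⁺ a β) (liftE Θ ts e) (++⁺ c α)
  represents-lift ts a β e r q = represents-++ (++⁺ a β) (split Θ ts inˡ) (wkE Θ (trs Θ ts) e)
    (to (represents-inˡ ts a β) r) (represents-wk a β e q)

  -- Meaning of the auxiliary formulae

  opaque
    unfolding θ≈-lifted encodes

    Gen-θ≈ : ∀ {Δ} (β : A ^ Δ) {a b} → Gen A (⟦_⟧₂ A (θ≈-lifted Θ) β) a b ⇔ a ≈ b
    Gen-θ≈ β = Gen-cong A λ a b → trans (sub-correct A (θ≈ Θ) _ _)
      (cong (A ⟦ θ≈ Θ ⟧_) (trans (map-++⁺ (inˡ {sorts Θ}) (wk (sorts Θ) (inˡ {sorts Θ})))
        (cong₂ ++⁺ (eval-inˡ a (++⁺ b β))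
          (trans (eval-wk a (++⁺ b β) inˡ) (eval-inˡ b β)))))

    ⊨-approx : ∀ {Δ} (x y : Vars Δ (sorts Θ)) (β : A ^ Δ) → A ⊨ approx Θ x y [ β ] ⇔ eval β x ≈ eval β y
    ⊨-approx x y β = ⊨-gen A (θ≈-lifted Θ) x y β ⨾ Gen-θ≈ β

    ⊨-θV : ∀ {Δ} (a : A ^ sorts Θ) (β : A ^ Δ) → A ⊨ sub (θV Θ) inˡ [ ++⁺ a β ] ⇔ A ⊨ θV Θ [ a ]
    ⊨-θV a β = ⊨-sub A (θV Θ) inˡ (++⁺ a β) ⨾ mk⇔ (subst (A ⊨ θV Θ [_]) (eval-inˡ a β))
                                                    (subst (A ⊨ θV Θ [_]) (sym (eval-inˡ a β)))

    ⊨-valid : ∀ {Δ} s (x : Vars Δ (tr Θ s)) (β : A ^ Δ) → A ⊨ valid Θ s x [ β ] ⇔ ∃ (Rep s (eval β x))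
    ⊨-valid str x β = ⊨-∃* A (sorts Θ) ⨾ (∃-⇔ λ a → T-∧ ⨾ ⊨-θV a β ×-⇔ (⊨-approx (wk (sorts Θ) x) inˡ (++⁺ a β) ⨾
        mk⇔ (subst₂ _≈_ (eval-wk a β x) (eval-inˡ a β))
            (subst₂ _≈_ (sym (eval-wk a β x)) (sym (eval-inˡ a β))))) ⨾
      mk⇔ (λ (a , v , x≈a) → let c , a≈c = complete classes-Θ v in c , ≈.trans x≈a a≈c)
          (λ (c , x≈c) → lookup (representatives Θ A) c , sound classes-Θ c , x≈c)
    ⊨-valid num q β = ⊨-∃* A (nums K) ⨾ (∃-⇔ λ m → T-∧ ⨾
        (⊨-classCount (sub (θV Θ) inˡ) (θ≈-lifted Θ) inˡ A (++⁺ m β)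
           (card-transfer classes-Θ _≡_
              (λ {a} t → a , refl , to (⊨-θV a (++⁺ m β)) t) (λ {a} t → a , refl , from (⊨-θV a (++⁺ m β)) t)
              (λ { refl refl → Gen-θ≈ (++⁺ m β) }))
         ⨾ mk⇔ (λ eq → trans eq (cong (value A K) (eval-inˡ m β)))
               (λ eq → trans eq (cong (value A K) (sym (eval-inˡ m β)))))
        ×-⇔ (T-not ⨾ ¬-cong-⇔ (⊨-ltT A K inˡ (wk (nums K) q) {++⁺ m β} ⨾
          mk⇔ (subst₂ (λ a b → value A K a < value A K b) (eval-inˡ m β) (eval-wk m β q))
              (subst₂ (λ a b → value A K a < value A K b) (sym (eval-inˡ m β)) (sym (eval-wk m β q))))))
      ⨾ mk⇔ (λ (m , eq , ≮) → let q≤ = s≤s (subst (value A K (eval β q) ≤_) (sym eq) (≮⇒≥ ≮))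
                              in Fin.fromℕ< q≤ , sym (Fin.toℕ-fromℕ< q≤))
            -- By `size-bound` the number of classes has a numeral of `K` digits, so the guess can
            -- succeed.
            (λ (m , eq) → let x , v = value-surjective A K (size B) size-bound
                          in x , sym v , λ p → ≤⇒≯ (Fin.toℕ≤pred[n] m) (subst₂ _<_ v eq p))

    ⊨-same : ∀ {Δ} s (x y : Vars Δ (tr Θ s)) (β : A ^ Δ) →
             A ⊨ same Θ s x y [ β ] ⇔ Sim s (eval β x) (eval β y)
    ⊨-same str x y β = ⊨-approx x y β
    ⊨-same num x y β = ⊨-eqT A x y

    ⊨-validE : ∀ {Δ Γ} (e : Env Θ Δ Γ) (β : A ^ Δ) → A ⊨ validE Θ e [ β ] ⇔ ∃ (Represents β e)
    ⊨-validE []                β = mk⇔ (λ _ → [] , []) (λ _ → ⊨-true A {β = β})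
    ⊨-validE {Γ = s ∷ Γ} (x ∷ e) β = T-∧ ⨾ (⊨-valid s x β ×-⇔ ⊨-validE e β) ⨾
      mk⇔ (λ ((c , r) , (cs , rs)) → c ∷ cs , r ∷ rs) (λ { (c ∷ cs , r ∷ rs) → (c , r) , (cs , rs) })

    ⊨-sameE : ∀ {Δ Γ} (e f : Env Θ Δ Γ) (β : A ^ Δ) → A ⊨ sameE Θ e f [ β ] ⇔ Sims (evalE β e) (evalE β f)
    ⊨-sameE []      []      β = mk⇔ (λ _ → []) (λ _ → ⊨-true A {β = β})
    ⊨-sameE {Γ = s ∷ Γ} (x ∷ e) (y ∷ f) β = T-∧ ⨾ (⊨-same s x y β ×-⇔ ⊨-sameE e f β) ⨾
      mk⇔ (λ (p , ps) → p ∷ ps) (λ { (p ∷ ps) → p , ps })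

    ⊨-sameT : ∀ {Δ} ts (a b : A ^ trs Θ ts) (β : A ^ Δ) →
              T (⟦_⟧₂ A (sameT Θ ts) β a b) ⇔ Sims (split Θ ts a) (split Θ ts b)
    ⊨-sameT ts a b β = ⊨-sameE (split Θ ts inˡ) (split Θ ts (wk (trs Θ ts) inˡ)) (++⁺ a (++⁺ b β)) ⨾
      mk⇔ (subst₂ Sims (evalE-inˡ ts a (++⁺ b β)) (evalE-second ts a b β))
          (subst₂ Sims (sym (evalE-inˡ ts a (++⁺ b β))) (sym (evalE-second ts a b β)))

    -- Similarity is already an equivalence, so generating adds nothing.
    Gen-sameT : ∀ {Δ} ts (a b : A ^ trs Θ ts) (β : A ^ Δ) →
                Gen A (⟦_⟧₂ A (sameT Θ ts) β) a b ⇔ Sims (split Θ ts a) (split Θ ts b)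
    Gen-sameT ts a b β = mk⇔ (Eq.gfold Sims-isEquivalence (split Θ ts) (λ {x} {y} → to (⊨-sameT ts x y β)))
                             (λ s → Eq.return (from (⊨-sameT ts a b β) s))

    -- Being represented bounds each block by the base of Θ[A], as the comparison of digits
    -- requires; an arbitrary block may exceed it.
    ⊨-ltE : ∀ {Δ} k (p q : Env Θ Δ (nums k)) {β : A ^ Δ} {m n} → Represents β p m → Represents β q n →
            A ⊨ ltE Θ k p q [ β ] ⇔ value B k m < value B k n
    ⊨-ltE zero    []      []      {β} {[]} {[]} [] [] = mk⇔ (λ t → ⊥-elim (⊨-false A {β = β} t)) (λ ())
    ⊨-ltE (suc k) (x ∷ p) (y ∷ q) {β} {m ∷ ms} {n ∷ ns} (r ∷ rs) (r′ ∷ rs′) =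
      T-∨ ⨾ (⊨-ltE k p q rs rs′ ⊎-⇔ (T-∧ ⨾
        (⊨-sameE p q β ⨾ Sims-≡ rs rs′ ⨾ mk⇔ (cong (value B k)) (value-injective B k))
        ×-⇔ (⊨-ltT A K x y ⨾ mk⇔ (subst₂ _<_ r r′) (subst₂ _<_ (sym r) (sym r′)))))
      ⨾ ⇔-sym (digit-cmp (Fin.toℕ<n m) (Fin.toℕ<n n))

    -- `value B k` maps the k-tuples of numbers bijectively onto an initial segment of the natural
    -- numbers, so exactly `value B k n` of them lie below `n`.
    ⊨-encodes : ∀ {Δ} k (p : Env Θ Δ (nums k)) (q : Vars Δ (nums (long Θ k))) {β : A ^ Δ} {n} →
                Represents β p n → A ⊨ encodes Θ k p q [ β ] ⇔ value B k n ≡ value A (long Θ k) (eval β q)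
    ⊨-encodes k p q {β} {n} r = ⊨-classCount _ (sameT Θ (nums k)) q A β
      (card-transfer (below-card (value B k n))
        (λ a x → ∃ λ m → Reps (split Θ (nums k) a) m × value B k m ≡ x)
        (λ {a} t → let v , l = to T-∧ t
                       m , s = to (⊨-validE (split Θ (nums k) inˡ) (++⁺ a β)) v
                   in value B k m , (m , from (represents-inˡ (nums k) a β) s , refl)
                      , to (⊨-ltE k _ _ s (represents-wk a β p r)) l)
        (λ {x} x<n → let m , v = value-surjective B k x (≤-trans x<n (<⇒≤ (value-bounded B k n)))
                         a , s = Reps-total m
                         s′    = to (represents-inˡ (nums k) a β) s
                     in a , (m , s , v) , from T-∧ (from (⊨-validE (split Θ (nums k) inˡ) (++⁺ a β)) (m , s′)
                        , from (⊨-ltE k _ _ s′ (represents-wk a β p r)) (subst (_< value B k n) (sym v) x<n)))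
        (λ { {a} {b} (m , s , refl) (m′ , s′ , refl) →
           Gen-sameT (nums k) a b β ⨾ Sims-≡ s s′ ⨾ mk⇔ (cong (value B k)) (value-injective B k) }))

  -- `K * k` digits already suffice, since k digits in base at most (|V(A)|+1)^K are converted; the
  -- extra digit in `long` keeps the numeral non-empty for k = 0.
  encoding : ∀ k (n : B ^ nums k) → ∃ λ (q : A ^ nums (long Θ k)) → value B k n ≡ value A (long Θ k) q
  encoding k n = let q , v = value-surjective A (long Θ k) (value B k n) bound in q , sym v
    where
    bound : value B k n < base A ℕ.^ long Θ k
    bound = begin-strict
      value B k n              <⟨ value-bounded B k n ⟩
      base B ℕ.^ k             ≤⟨ ^-monoˡ-≤ k size-bound ⟩
      (base A ℕ.^ K) ℕ.^ k     ≡⟨ ^-*-assoc (base A) K k ⟩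
      base A ℕ.^ (K * k)       ≤⟨ m≤m+n _ _ ⟩
      base A ℕ.^ long Θ k      ∎
      where open ≤-Reasoning

-- Relation symbols

∈-vectors⁺ : ∀ {X : Set} {xs : List X} {n} (v : Vec X n) → VAll (_∈ xs) v → v ∈ vectors xs n
∈-vectors⁺ []      []       = here refl
∈-vectors⁺ (x ∷ v) (p ∷ ps) = ∈-cartesianProductWith⁺ _∷_ p (∈-vectors⁺ v ps)

∈-vectors⁻ : ∀ {X : Set} {xs : List X} n {v : Vec X n} → v ∈ vectors xs n → VAll (_∈ xs) v
∈-vectors⁻ zero {[]} _ = []
∈-vectors⁻ {xs = xs} (suc n) p with ∈-cartesianProductWith⁻ _∷_ xs (vectors xs n) p
... | _ , _ , q , qs , refl = q ∷ ∈-vectors⁻ n qs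

module _ {τ₁ τ₂ : Vocabulary} (Θ : Transduction τ₁ τ₂) (A : Structure τ₁) (d : Defined Θ A) where
  open Representation Θ A d

  Sim-≡ : ∀ s {a b c c′} → Rep s a c → Rep s b c′ → Sim s a b ⇔ c ≡ c′
  Sim-≡ s r r′ = mk⇔ (λ p → Rep-functional s (to (Rep-Sim s r) p) r′)
                     (λ { refl → from (Rep-Sim s r) r′ })

  represents-∷ : ∀ s {Δ Γ} (a : A ^ tr Θ s) (β : A ^ Δ) (e : Env Θ Δ Γ) {c α} → Rep s a c → Represents β e α →
                 Represents (++⁺ a β) (inˡ ∷ wkE Θ (tr Θ s) e) (c ∷ α)
  represents-∷ s a β e {c} r q = subst (λ x → Rep s x c) (sym (eval-inˡ a β)) r ∷ represents-wk a β e q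

  ⊨-valid-inˡ : ∀ {Δ} s (a : A ^ tr Θ s) (β : A ^ Δ) → A ⊨ valid Θ s inˡ [ ++⁺ a β ] ⇔ ∃ (Rep s a)
  ⊨-valid-inˡ s a β = ⊨-valid s inˡ (++⁺ a β) ⨾ ∃-⇔ λ c →
    mk⇔ (subst (λ x → Rep s x c) (eval-inˡ a β)) (subst (λ x → Rep s x c) (sym (eval-inˡ a β)))

  Matches : ∀ {n} → Vec (A ^ sorts Θ) n → Vec (V B) n → Set
  Matches = Pointwise (λ a c → A ⊨ θV Θ [ a ] × Rep str a c)

  opaque
    unfolding matches

    ⊨-matches : ∀ {Δ Γ n} (f : str ∈ Γ → Vars Δ (sorts Θ)) (β : A ^ Δ) (α : B ^ Γ) →
                (∀ x → Rep str (eval β (f x)) (All.lookup α x)) →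
                (bs : Vec (Vars Δ (sorts Θ)) n) (xs : Vec (str ∈ Γ) n) →
                A ⊨ matches Θ bs (Vec.map f xs) [ β ] ⇔ Matches (Vec.map (eval β) bs) (Vec.map (All.lookup α) xs)
    ⊨-matches f β α r []       []       = mk⇔ (λ _ → []) (λ _ → ⊨-true A {β = β})
    ⊨-matches f β α r (b ∷ bs) (x ∷ xs) = T-∧ ⨾
      (T-∧ ⨾ ⊨-sub A (θV Θ) b β ×-⇔ (⊨-approx b (f x) β ⨾
         mk⇔ (λ p → ≈.trans p (r x)) (λ p → ≈.trans p (≈.sym (r x)))))
      ×-⇔ ⊨-matches f β α r bs xs ⨾
      mk⇔ (λ (p , ps) → p ∷ ps) (λ { (p ∷ ps) → p , ps })

  Matches-domain : ∀ {n} {as : Vec (A ^ sorts Θ) n} {cs} →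
                   (as ∈ vectors (domain Θ A) n × Pointwise (_/≈≡_ Θ A) as cs) ⇔ Matches as cs
  Matches-domain {n} = mk⇔ (λ (p , q) → combine (∈-vectors⁻ n p) q) (λ m → ∈-vectors⁺ _ (members m) , Pointwise.map proj₂ m)
    where
    combine : ∀ {n} {as : Vec _ n} {cs} → VAll (_∈ domain Θ A) as → Pointwise (_/≈≡_ Θ A) as cs → Matches as cs
    combine []       []       = []
    combine (p ∷ ps) (q ∷ qs) = (proj₂ (∈-filter⁻ (λ a → T? (A ⟦ θV Θ ⟧ a)) {xs = tuples A (sorts Θ)} p) , q) ∷ combine ps qs
    members : ∀ {n} {as : Vec _ n} {cs} → Matches as cs → VAll (_∈ domain Θ A) as
    members []             = []
    members ((p , _) ∷ ps) = ∈-filter⁺ (λ a → T? (A ⟦ θV Θ ⟧ a)) (tuples-complete A _) p ∷ members ps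

  interp-iff : ∀ R cs → T (interp B R cs) ⇔ (∃[ as ] (Matches as cs × A ⊨ θR Θ R [ flatten as ]))
  interp-iff R cs = mk⇔
    (λ t → let as , p , q = find (any⁻ _ (vectors (domain Θ A) (ar τ₂ R)) t)
               q₁ , q₂    = to T-∧ q
           in as , to Matches-domain (p , to (T-⌊⌋ (Pointwise.decidable (_/≈≡?_ Θ A) as cs)) q₁) , q₂)
    (λ (as , m , q₂) → let p , q₁ = from Matches-domain m
           in any⁺ _ (lose p (from T-∧ (from (T-⌊⌋ (Pointwise.decidable (_/≈≡?_ Θ A) as cs)) q₁ , q₂))))

  translate-rel : ∀ {Δ Γ} R xs (e : Env Θ Δ Γ) {β : A ^ Δ} {α} → Represents β e α →
                  A ⊨ translate Θ (rel R xs) e [ β ] ⇔ B ⊨ rel R xs [ α ]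
  translate-rel R xs e {β} {α} r = ⊨-∃* A cs ⨾ (∃-⇔ λ a → T-∧ ⨾
      (⊨-matches (λ x → wk cs (All.lookup e x)) (++⁺ a β) α
         (λ x → subst (λ y → Rep str y (All.lookup α x)) (sym (eval-wk a β (All.lookup e x))) (represents-lookup β e r x))
         (unflatten n inˡ) xs ⨾ mk⇔ (subst (λ v → Matches v _) (eq a)) (subst (λ v → Matches v _) (sym (eq a))))
      ×-⇔ (⊨-sub A (θR Θ R) inˡ (++⁺ a β) ⨾ mk⇔ (subst (A ⊨ θR Θ R [_]) (eval-inˡ a β))
                                                  (subst (A ⊨ θR Θ R [_]) (sym (eval-inˡ a β))))) ⨾
    mk⇔ (λ (a , m , t) → unflatten n a , m , subst (A ⊨ θR Θ R [_]) (sym (flatten-unflatten n a)) t)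
        (λ (as , m , t) → flatten as , subst (λ v → Matches v _) (sym (unflatten-flatten as)) m , t)
    ⨾ ⇔-sym (interp-iff R (Vec.map (All.lookup α) xs))
    where
    n = ar τ₂ R
    cs = copies n (sorts Θ)
    eq : ∀ a → Vec.map (eval (++⁺ a β)) (unflatten n inˡ) ≡ unflatten n a
    eq a = trans (map-unflatten n inˡ) (cong (unflatten n) (eval-inˡ a β))

  -- Counting

  translate-count : ∀ {Δ Γ} ts {k} (ψ : Formula τ₂ (ts ++ Γ)) (p : All (_∈ Γ) (nums k)) (e : Env Θ Δ Γ)
    {β : A ^ Δ} {α} → Represents β e α →
    (∀ {Δ′} (f : Env Θ Δ′ (ts ++ Γ)) {γ : A ^ Δ′} {δ} → Represents γ f δ → A ⊨ translate Θ ψ f [ γ ] ⇔ B ⊨ ψ [ δ ]) →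
    A ⊨ translate Θ (count ts ψ p) e [ β ] ⇔ B ⊨ count ts ψ p [ α ]
  translate-count {Δ} {Γ} ts {k} ψ p e {β} {α} r ih = ⊨-∃* A (nums (long Θ k)) ⨾
    (∃-⇔ λ q → T-∧ ⨾ encodes-iff q ×-⇔ count-iff q) ⨾
    mk⇔ (λ (_ , v , c) → trans c (sym v)) (λ eq → let q , v = encoding k (eval α p) in q , v , trans eq v) ⨾
    ⇔-sym T-≡ᵇ
    where
    n : ℕ
    n = length (filterᵇ (λ c → B ⟦ ψ ⟧ ++⁺ c α) (tuples B ts))

    module _ (q : A ^ nums (long Θ k)) where
      β′ : A ^ (nums (long Θ k) ++ Δ)
      β′ = ++⁺ q β
      e′ : Env Θ (nums (long Θ k) ++ Δ) Γ
      e′ = wkE Θ (nums (long Θ k)) e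
      r′ : Represents β′ e′ α
      r′ = represents-wk q β e r

      value-inˡ : ∀ {m : ℕ} → m ≡ value A (long Θ k) (eval β′ inˡ) ⇔ m ≡ value A (long Θ k) q
      value-inˡ = mk⇔ (λ v → trans v (cong (value A (long Θ k)) (eval-inˡ q β)))
                      (λ v → trans v (cong (value A (long Θ k)) (sym (eval-inˡ q β))))

      encodes-iff : A ⊨ encodes Θ k (All.map (All.lookup e′) p) inˡ [ β′ ] ⇔
                    value B k (eval α p) ≡ value A (long Θ k) q
      encodes-iff = ⊨-encodes k _ inˡ (represents-select β′ e′ r′ p) ⨾ value-inˡ

      ψ-iff : ∀ {a c} → Reps (split Θ ts a) c →
              A ⊨ translate Θ ψ (liftE Θ ts e′) [ ++⁺ a β′ ] ⇔ B ⊨ ψ [ ++⁺ c α ]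
      ψ-iff {a} s = ih (liftE Θ ts e′) (represents-lift ts a β′ e′ s r′)

      -- Tuples of Θ[A] up to equality are matched with valid tuples of A up to similarity.
      count-iff : A ⊨ classCount (validE Θ (split Θ ts inˡ) ∧′ translate Θ ψ (liftE Θ ts e′)) (sameT Θ ts) inˡ [ β′ ]
                  ⇔ n ≡ value A (long Θ k) q
      count-iff = ⊨-classCount _ (sameT Θ ts) inˡ A β′
        (card-transfer (filter-card (tuples-complete B) (tuples-unique B ts) (λ c → B ⟦ ψ ⟧ ++⁺ c α))
          (λ a c → Reps (split Θ ts a) c)
          (λ {a} t → let v , t′ = to T-∧ t
                         c , s  = to (⊨-validE (split Θ ts inˡ) (++⁺ a β′)) v
                         s′     = from (represents-inˡ ts a β′) s
                     in c , s′ , to (ψ-iff s′) t′)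
          (λ {c} t → let a , s = Reps-total c
                     in a , s , from T-∧ (from (⊨-validE (split Θ ts inˡ) (++⁺ a β′)) (c , to (represents-inˡ ts a β′) s)
                                         , from (ψ-iff s) t))
          (λ {a} {b} s s′ → Gen-sameT ts a b β′ ⨾ Sims-≡ s s′))
        ⨾ value-inˡ

  -- The recursion operator

  opaque
    unfolding both

    ⊨-both : ∀ {Δ} ts {χ : Formula τ₁ (trs Θ ts ++ trs Θ ts ++ Δ)} {Q : B ^ ts → B ^ ts → Set} a b (β : A ^ Δ) →
             (∀ {c c′} → Reps (split Θ ts a) c → Reps (split Θ ts b) c′ → A ⊨ χ [ ++⁺ a (++⁺ b β) ] ⇔ Q c c′) →
             A ⊨ both Θ ts χ [ ++⁺ a (++⁺ b β) ] ⇔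
             (∃[ c ] ∃[ c′ ] (Reps (split Θ ts a) c × Reps (split Θ ts b) c′ × Q c c′))
    ⊨-both {Δ} ts a b β iff = T-∧ ⨾
      (⊨-validE (split Θ ts inˡ) γ ⨾ ∃-⇔ λ c → ⇔-sym (represents-inˡ ts a (++⁺ b β))) ×-⇔
      (T-∧ ⨾ (⊨-validE (split Θ ts (wk (trs Θ ts) inˡ)) γ ⨾ ∃-⇔ λ c →
        mk⇔ (subst (λ as → Reps as c) (evalE-second ts a b β))
            (subst (λ as → Reps as c) (sym (evalE-second ts a b β)))) ×-⇔ ⇔-id _) ⨾
      mk⇔ (λ ((c , s) , (c′ , s′) , t) → c , c′ , s , s′ , to (iff s s′) t)
          (λ (c , c′ , s , s′ , t) → (c , s) , (c′ , s′) , from (iff s s′) t)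
      where
      γ : A ^ (trs Θ ts ++ trs Θ ts ++ Δ)
      γ = ++⁺ a (++⁺ b β)

  -- Context and environment are quantified inside the induction hypothesis because binders and
  -- auxiliary variables change both.
  Correct : ∀ {Γ} → Formula τ₂ Γ → Set
  Correct {Γ} φ = ∀ {Δ} (e : Env Θ Δ Γ) {β : A ^ Δ} {α} → Represents β e α →
                  A ⊨ translate Θ φ e [ β ] ⇔ B ⊨ φ [ α ]

  module _ {Δ Γ} ts {k j} (φ₌ φE : Formula τ₂ (ts ++ ts ++ Γ)) (φC : Formula τ₂ (ts ++ nums (suc k) ++ Γ))
    (w : All (_∈ Γ) ts) (rs : All (_∈ Γ) (nums (suc j))) (e : Env Θ Δ Γ)
    {β : A ^ Δ} {α} (r : Represents β e α)
    (ih₌ : Correct φ₌) (ihE : Correct φE) (ihC : Correct φC) where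

    private
      L : ℕ
      L = long Θ (suc j)

      module _ (q : A ^ nums L) where
        β′ : A ^ (nums L ++ Δ)
        β′ = ++⁺ q β
        e′ : Env Θ (nums L ++ Δ) Γ
        e′ = wkE Θ (nums L) e
        r′ : Represents β′ e′ α
        r′ = represents-wk q β e r

        ns : Ctx
        ns = trs Θ (nums (suc k))

        M : ℕ
        M = long Θ (suc k)

        envC : Env Θ (ns ++ trs Θ ts ++ nums M ++ nums L ++ Δ) (ts ++ nums (suc k) ++ Γ)
        envC = ++⁺ (wkE Θ ns (split Θ ts inˡ)) (++⁺ (split Θ (nums (suc k)) inˡ)
                 (wkE Θ ns (wkE Θ (trs Θ ts) (wkE Θ (nums M) e′))))

        χ₌ χE : Formula τ₁ (trs Θ ts ++ trs Θ ts ++ nums L ++ Δ)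
        χ₌ = sameT Θ ts ∨′ both Θ ts (translate Θ φ₌ (liftE Θ ts (liftE Θ ts e′)))
        χE = both Θ ts (translate Θ φE (liftE Θ ts (liftE Θ ts e′)))

        χC : Formula τ₁ (trs Θ ts ++ nums M ++ nums L ++ Δ)
        χC = ∃* ns (validE Θ (split Θ (nums (suc k)) inˡ) ∧′ translate Θ φC envC ∧′
                    encodes Θ (suc k) (split Θ (nums (suc k)) inˡ) (wk ns (wk (trs Θ ts) inˡ)))

        ws : Env Θ (nums L ++ Δ) ts
        ws = All.map (All.lookup e′) w

        lift₂ : ∀ {a b c c′} → Reps (split Θ ts a) c → Reps (split Θ ts b) c′ →
                Represents (++⁺ a (++⁺ b β′)) (liftE Θ ts (liftE Θ ts e′)) (++⁺ c (++⁺ c′ α))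
        lift₂ {a} {b} s s′ = represents-lift ts a (++⁺ b β′) (liftE Θ ts e′) s (represents-lift ts b β′ e′ s′ r′)

        representsC : ∀ {a c} (n : A ^ nums M) (x : A ^ ns) {n′} → Reps (split Θ ts a) c → Reps (split Θ (nums (suc k)) x) n′ →
                      Represents (++⁺ x (++⁺ a (++⁺ n β′))) envC (++⁺ c (++⁺ n′ α))
        representsC {a} n x s t = represents-++ γ (wkE Θ ns (split Θ ts inˡ)) _
          (represents-wk x (++⁺ a (++⁺ n β′)) (split Θ ts inˡ) (to (represents-inˡ ts a (++⁺ n β′)) s))
          (represents-++ γ (split Θ (nums (suc k)) inˡ) (wkE Θ ns (wkE Θ (trs Θ ts) (wkE Θ (nums M) e′)))
            (to (represents-inˡ (nums (suc k)) x (++⁺ a (++⁺ n β′))) t)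
            (represents-wk x (++⁺ a (++⁺ n β′)) (wkE Θ (trs Θ ts) (wkE Θ (nums M) e′))
              (represents-wk a (++⁺ n β′) (wkE Θ (nums M) e′) (represents-wk n β′ e′ r′))))
          where γ = ++⁺ x (++⁺ a (++⁺ n β′))

        χC-iff : ∀ {a c} → Reps (split Θ ts a) c → (n : A ^ nums M) →
                 A ⊨ χC [ ++⁺ a (++⁺ n β′) ] ⇔
                 (∃[ n′ ] (B ⊨ φC [ ++⁺ c (++⁺ n′ α) ] × value B (suc k) n′ ≡ value A M n))
        χC-iff {a} {c} s n = ⊨-∃* A ns ⨾ mk⇔
          (λ (x , t) → let v , t′  = to T-∧ t
                           t₁ , t₂ = to T-∧ t′
                           n′ , u  = to (⊨-validE numE (γ x)) v
                           u′      = from (represents-inˡ (nums (suc k)) x (++⁺ a (++⁺ n β′))) u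
                       in n′ , to (ihC envC (representsC n x s u′)) t₁ , trans (to (⊨-encodes (suc k) numE nE u) t₂) (eval-n x))
          (λ (n′ , t , v) → let x , u = Reps-total n′
                                u′    = to (represents-inˡ (nums (suc k)) x (++⁺ a (++⁺ n β′))) u
                            in x , from T-∧ (from (⊨-validE numE (γ x)) (n′ , u′)
                                 , from T-∧ (from (ihC envC (representsC n x s u)) t
                                            , from (⊨-encodes (suc k) numE nE u′) (trans v (sym (eval-n x))))))
          where
          γ : A ^ ns → A ^ (ns ++ trs Θ ts ++ nums M ++ nums L ++ Δ)
          γ x = ++⁺ x (++⁺ a (++⁺ n β′))
          numE : Env Θ (ns ++ trs Θ ts ++ nums M ++ nums L ++ Δ) (nums (suc k))
          numE = split Θ (nums (suc k)) inˡ
          nE : Vars (ns ++ trs Θ ts ++ nums M ++ nums L ++ Δ) (nums M)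
          nE = wk ns (wk (trs Θ ts) inˡ)
          eval-n : ∀ x → value A M (eval (γ x) nE) ≡ value A M n
          eval-n x = cong (value A M) (trans (eval-wk x (++⁺ a (++⁺ n β′)) (wk (trs Θ ts) inˡ))
            (trans (eval-wk a (++⁺ n β′) inˡ) (eval-inˡ n β′)))

        rec-iff : A ⊨ lrec (trs Θ ts) {width Θ * suc k} {width Θ * suc j} χ₌ χE χC (join Θ ws) inˡ [ β′ ] ⇔
                  T (LRec.inX B ts {suc k} (⟦_⟧₂ B φ₌ α) (⟦_⟧₂ B φE α) (λ c n → B ⟦ φC ⟧ ++⁺ c (++⁺ n α))
                     (eval α w) (value A L q))
        rec-iff = mk⇔ (subst T eq) (subst T (sym eq))
          where
          w-reps : Reps (split Θ ts (eval β′ (join Θ ws))) (eval α w)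
          w-reps = subst (λ as → Reps as (eval α w))
            (trans (cong (evalE β′) (sym (split-join Θ ws))) (map-split Θ ts (join Θ ws)))
            (represents-select β′ e′ r′ w)

          eq : A ⟦ lrec (trs Θ ts) {width Θ * suc k} {width Θ * suc j} χ₌ χE χC (join Θ ws) inˡ ⟧ β′ ≡ _
          eq = trans (QuotientSimulation.inX-quotient A B
            (⟦_⟧₂ A χ₌ β′) (⟦_⟧₂ A χE β′) (λ a n → A ⟦ χC ⟧ ++⁺ a (++⁺ n β′))
            (⟦_⟧₂ B φ₌ α) (⟦_⟧₂ B φE α) (λ c n → B ⟦ φC ⟧ ++⁺ c (++⁺ n α))
            (λ a c → Reps (split Θ ts a) c) (λ a b → Sims (split Θ ts a) (split Θ ts b))
            Reps-total Reps-Sims Sims-sym Reps-functional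
            (λ a b → T-∨ ⨾ ⊨-sameT ts a b β′ ⊎-⇔
              ⊨-both ts a b β′ (λ s s′ → ih₌ (liftE Θ ts (liftE Θ ts e′)) (lift₂ s s′)))
            (λ a b → ⊨-both ts a b β′ (λ s s′ → ihE (liftE Θ ts (liftE Θ ts e′)) (lift₂ s s′)))
            -- Label sets are compared as sets of numbers. Each label from Θ[A] has a numeral over A
            -- by `encoding`; conversely `χC` admits only values of numerals of Θ[A].
            (λ s m → mk⇔
              (λ (n , t , v) → let n′ , t′ , v′ = to (χC-iff s n) t in n′ , t′ , trans v′ v)
              (λ (n′ , t , v) → let n , v′ = encoding (suc k) n′
                                in n , from (χC-iff s n) (n′ , t , v′) , trans (sym v′) v))
            (value A L (eval β′ inˡ)) w-reps)
            (cong (λ x → LRec.inX B ts {suc k} (⟦_⟧₂ B φ₌ α) (⟦_⟧₂ B φE α) (λ c n → B ⟦ φC ⟧ ++⁺ c (++⁺ n α))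
                           (eval α w) (value A L x)) (eval-inˡ q β))

        encodes-iff : A ⊨ encodes Θ (suc j) (All.map (All.lookup e′) rs) inˡ [ β′ ] ⇔
                      value B (suc j) (eval α rs) ≡ value A L q
        encodes-iff = ⊨-encodes (suc j) _ inˡ (represents-select β′ e′ r′ rs) ⨾
          mk⇔ (λ v → trans v (cong (value A L) (eval-inˡ q β)))
              (λ v → trans v (cong (value A L) (sym (eval-inˡ q β))))

    translate-lrec : A ⊨ translate Θ (lrec ts φ₌ φE φC w rs) e [ β ] ⇔ B ⊨ lrec ts φ₌ φE φC w rs [ α ]
    translate-lrec = ⊨-∃* A (nums L) ⨾ (∃-⇔ λ q → T-∧ ⨾ encodes-iff q ×-⇔ rec-iff q) ⨾ mk⇔
      (λ (q , v , t) → subst (λ ℓ → T (inX ℓ)) (sym v) t)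
      (λ t → let q , v = encoding (suc j) (eval α rs) in q , v , subst (λ ℓ → T (inX ℓ)) v t)
      where
      inX : ℕ → Bool
      inX = LRec.inX B ts {suc k} (⟦_⟧₂ B φ₌ α) (⟦_⟧₂ B φE α) (λ c n → B ⟦ φC ⟧ ++⁺ c (++⁺ n α)) (eval α w)

  -- Induction on formulae

  translate-correct : ∀ {Γ} (φ : Formula τ₂ Γ) → Correct φ
  translate-correct (equal {s} x y) e {β} {α} r = ⊨-same s (All.lookup e x) (All.lookup e y) β ⨾
    Sim-≡ s (represents-lookup β e r x) (represents-lookup β e r y) ⨾ ⇔-sym (⊨-equal B {x = x} {y} {α})
  translate-correct (rel R xs) e r = translate-rel R xs e r
  translate-correct (leq p q) e {β} {α} r = T-not ⨾ ¬-cong-⇔ (⊨-ltT A K (All.lookup e q) (All.lookup e p)) ⨾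
    mk⇔ (λ ≮ → subst₂ _≤_ (represents-lookup β e r p) (represents-lookup β e r q) (≮⇒≥ ≮))
        (λ ≤ → ≤⇒≯ (subst₂ _≤_ (sym (represents-lookup β e r p)) (sym (represents-lookup β e r q)) ≤)) ⨾
    ⇔-sym (⊨-leq B {x = p} {q} {α})
  translate-correct (¬′ φ)   e r = T-not ⨾ ¬-cong-⇔ (translate-correct φ e r) ⨾ ⇔-sym T-not
  translate-correct (φ ∧′ ψ) e r = T-∧ ⨾ translate-correct φ e r ×-⇔ translate-correct ψ e r ⨾ ⇔-sym T-∧
  translate-correct (φ ∨′ ψ) e r = T-∨ ⨾ (translate-correct φ e r ⊎-⇔ translate-correct ψ e r) ⨾ ⇔-sym T-∨
  translate-correct (∃′ s φ) e {β} {α} r = ⊨-∃* A (tr Θ s) ⨾ mk⇔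
    (λ (a , t) → let v , t′ = to T-∧ t
                     c , q  = to (⊨-valid-inˡ s a β) v
                 in c , to (translate-correct φ _ (represents-∷ s a β e q r)) t′)
    (λ (c , t) → let a , q = Rep-total s c
                 in a , from T-∧ (from (⊨-valid-inˡ s a β) (c , q)
                                 , from (translate-correct φ _ (represents-∷ s a β e q r)) t)) ⨾
    ⇔-sym (⊨-∃ B {s = s} {φ} {α})
  translate-correct (∀′ s φ) e {β} {α} r = T-not ⨾ ¬-cong-⇔ (⊨-∃* A (tr Θ s)) ⨾ mk⇔
    (λ ¬∃ c → decidable-stable (T? _) λ ¬t → let a , q = Rep-total s c in
      ¬∃ (a , from T-∧ (from (⊨-valid-inˡ s a β) (c , q)
                       , from T-not (λ t → ¬t (to (translate-correct φ _ (represents-∷ s a β e q r)) t)))))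
    (λ f (a , t) → let v , t′ = to T-∧ t
                       c , q  = to (⊨-valid-inˡ s a β) v
                   in to T-not t′ (from (translate-correct φ _ (represents-∷ s a β e q r)) (f c))) ⨾
    ⇔-sym (⊨-∀ B {s = s} {φ} {α})
  translate-correct (count ts ψ p) e r = translate-count ts ψ p e r (translate-correct ψ)
  translate-correct (lrec ts φ₌ φE φC w rs) e r =
    translate-lrec ts φ₌ φE φC w rs e r (translate-correct φ₌) (translate-correct φE) (translate-correct φC)

-- The formula for given parameters

assignAll : ∀ (Q : Sort → Set) {κ lam} → Vec (Q str) κ → Vec (Q num) lam → All Q (replicate κ str ++ nums lam)
assignAll Q (x ∷ xs) ns       = x ∷ assignAll Q xs ns
assignAll Q []       []       = []
assignAll Q []       (n ∷ ns) = n ∷ assignAll Q [] ns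

map-assignAll : ∀ (Q R : Sort → Set) (f : ∀ {s} → Q s → R s) {κ lam} (xs : Vec (Q str) κ) (ns : Vec (Q num) lam) →
                All.map f (assignAll Q xs ns) ≡ assignAll R (Vec.map f xs) (Vec.map f ns)
map-assignAll Q R f (x ∷ xs) ns       = cong (f x ∷_) (map-assignAll Q R f xs ns)
map-assignAll Q R f []       []       = refl
map-assignAll Q R f []       (n ∷ ns) = cong (f n ∷_) (map-assignAll Q R f [] ns)

-- The new digit is the most significant one.
extend : ∀ {P : Sort → Set} k → All P (nums k) → P num → All P (nums (suc k))
extend zero    []       z = z ∷ []
extend (suc k) (n ∷ ns) z = n ∷ extend k ns z

map-extend : ∀ {P Q : Sort → Set} {f : ∀ {s} → P s → Q s} k (ns : All P (nums k)) z →
             All.map f (extend k ns z) ≡ extend k (All.map f ns) (f z)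
map-extend zero    []       z = refl
map-extend (suc k) (n ∷ ns) z = cong (_ ∷_) (map-extend k ns z)

value-extend : ∀ {τ} (A : Structure τ) k (ns : A ^ nums k) → value A (suc k) (extend k ns Fin.zero) ≡ value A k ns
value-extend A zero    []       = refl
value-extend A (suc k) (n ∷ ns) = cong (λ v → toℕ n + v * base A) (value-extend A k ns)

module _ {τ₁ τ₂ : Vocabulary} (Θ : Transduction τ₁ τ₂) (A : Structure τ₁) (d : Defined Θ A) where
  open Representation Θ A d

  Digits : A ^ nums (arity Θ) → Dom B num → Set
  Digits n m = value A (arity Θ) n ≡ toℕ m

  -- Number parameters come with `arity Θ` digits, one fewer than the translation uses; a leading
  -- zero leaves the value unchanged.
  numeral : A ^ nums (arity Θ) → A ^ nums K
  numeral n = extend (arity Θ) n Fin.zero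

  assignReps : ∀ {κ lam} → Vec (A ^ sorts Θ) κ → Vec (A ^ nums (arity Θ)) lam →
               All (λ s → A ^ tr Θ s) (replicate κ str ++ nums lam)
  assignReps as ns = assignAll (λ s → A ^ tr Θ s) as (Vec.map numeral ns)

  Reps-assign⁺ : ∀ {κ lam} {as : Vec (A ^ sorts Θ) κ} {ns : Vec (A ^ nums (arity Θ)) lam}
                 {cs : Vec (V B) κ} {ms : Vec (Dom B num) lam} →
                 Pointwise (_/≈≡_ Θ A) as cs → Pointwise Digits ns ms →
                 Reps (assignReps as ns) (assign {A = B} cs ms)
  Reps-assign⁺               (p ∷ ps) q        = p ∷ Reps-assign⁺ ps q
  Reps-assign⁺               []       []       = []
  Reps-assign⁺ {ns = n ∷ ns} []       (q ∷ qs) = trans (value-extend A (arity Θ) n) q ∷ Reps-assign⁺ [] qs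

  Reps-assign⁻ : ∀ {κ lam} (as : Vec (A ^ sorts Θ) κ) (ns : Vec (A ^ nums (arity Θ)) lam)
                 {α : B ^ (replicate κ str ++ nums lam)} → Reps (assignReps as ns) α →
                 Σ[ cs ∈ Vec (V B) κ ] Σ[ ms ∈ Vec (Dom B num) lam ]
                   Pointwise (_/≈≡_ Θ A) as cs × Pointwise Digits ns ms × α ≡ assign {A = B} cs ms
  Reps-assign⁻ (a ∷ as) ns {c ∷ α} (r ∷ rs) =
    let cs , ms , p , q , eq = Reps-assign⁻ as ns rs in c ∷ cs , ms , r ∷ p , q , cong (c ∷_) eq
  Reps-assign⁻ []       ns {α}     rs       = let ms , q , eq = go ns rs in [] , ms , [] , q , eq
    where
    go : ∀ {lam} (ns : Vec (A ^ nums (arity Θ)) lam) {α : B ^ nums lam} → Reps (assignReps [] ns) α →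
         Σ[ ms ∈ Vec (Dom B num) lam ] Pointwise Digits ns ms × α ≡ assign {A = B} [] ms
    go []       {[]}    []       = [] , [] , refl
    go (n ∷ ns) {m ∷ α} (r ∷ rs) = let ms , q , eq = go ns rs in
      m ∷ ms , trans (sym (value-extend A (arity Θ) n)) r ∷ q , cong (m ∷_) eq

module _ {τ₁ τ₂ : Vocabulary} (Θ : Transduction τ₁ τ₂) (κ lam : ℕ) (φ : Formula τ₂ (replicate κ str ++ nums lam)) where
  private
    Δ : Ctx
    Δ = copies κ (sorts Θ) ++ copies lam (nums (arity Θ))

    strVars : Vars (num ∷ Δ) (copies κ (sorts Θ))
    strVars = wk (num ∷ []) inˡ

    numVars : Vars (num ∷ Δ) (copies lam (nums (arity Θ)))
    numVars = wk (num ∷ []) (wk (copies κ (sorts Θ)) allVars)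

    params : Env Θ (num ∷ Δ) (replicate κ str ++ nums lam)
    params = assignAll (λ s → Vars (num ∷ Δ) (tr Θ s)) (unflatten κ strVars)
      (Vec.map (λ p → extend (arity Θ) p (here refl)) (unflatten lam numVars))

  -- The bound variable is the leading zero shared by all number parameters. `validE` asserts that
  -- the parameters denote elements and numbers of Θ[A], without which the translation has no
  -- specified meaning.
  pullback : Formula τ₁ Δ
  pullback = ∃′ num (isZero (here refl) ∧′ validE Θ params ∧′ translate Θ φ params)

  module _ (A : Structure τ₁) (d : Defined Θ A) (as : Vec (A ^ sorts Θ) κ) (ns : Vec (A ^ nums (arity Θ)) lam) where
    open Representation Θ A d

    private
      β : A ^ Δ
      β = ++⁺ (flatten as) (flatten ns)

      β₀ : A ^ (num ∷ Δ)
      β₀ = Fin.zero ∷ β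

    evalE-params : evalE β₀ params ≡ assignReps Θ A d as ns
    evalE-params = trans (map-assignAll (λ s → Vars (num ∷ Δ) (tr Θ s)) (λ s → A ^ tr Θ s) (eval β₀) us _)
      (cong₂ (assignAll (λ s → A ^ tr Θ s)) us-eq
        (trans (sym (Vec.map-∘ (eval β₀) (λ p → extend (arity Θ) p (here refl)) ps))
        (trans (Vec.map-cong (λ p → map-extend (arity Θ) p (here refl)) ps)
        (trans (Vec.map-∘ (numeral Θ A d) (eval β₀) ps)
        (cong (Vec.map (numeral Θ A d)) ps-eq)))))
      where
      us : Vec (Vars (num ∷ Δ) (sorts Θ)) κ
      us = unflatten κ strVars
      ps : Vec (Vars (num ∷ Δ) (nums (arity Θ))) lam
      ps = unflatten lam numVars
      us-eq : Vec.map (eval β₀) us ≡ as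
      us-eq = trans (map-unflatten κ strVars) (trans (cong (unflatten κ)
        (trans (eval-wk (Fin.zero ∷ []) β inˡ) (eval-inˡ (flatten as) (flatten ns))))
        (unflatten-flatten as))
      ps-eq : Vec.map (eval β₀) ps ≡ ns
      ps-eq = trans (map-unflatten lam numVars) (trans (cong (unflatten lam)
        (trans (eval-wk (Fin.zero ∷ []) β (wk (copies κ (sorts Θ)) allVars))
        (trans (eval-wk (flatten as) (flatten ns) allVars) (eval-allVars (flatten ns)))))
        (unflatten-flatten ns))

    pullback-correct : A ⊨ pullback [ β ] ⇔
      (Σ[ cs ∈ Vec (V B) κ ] Σ[ ms ∈ Vec (Dom B num) lam ]
        Pointwise (_/≈≡_ Θ A) as cs × Pointwise (Digits Θ A d) ns ms × B ⊨ φ [ assign {A = B} cs ms ])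
    pullback-correct = ⊨-∃ A {s = num} {isZero (here refl) ∧′ validE Θ params ∧′ translate Θ φ params} {β} ⨾ mk⇔
      (λ (z , t) → let z≡0 , t′ = to T-∧ t
                   in to T-∧ (subst (λ z → A ⊨ validE Θ params ∧′ translate Θ φ params [ z ∷ β ])
                                    (to (⊨-isZero A (here refl) {z ∷ β}) z≡0) t′))
      (λ t → Fin.zero , from T-∧ (from (⊨-isZero A (here refl) {β₀}) refl , from T-∧ t))
      ⨾ (⊨-validE params β₀ ×-⇔ ⇔-id _) ⨾ mk⇔
      (λ ((α , r) , t) →
        let cs , ms , p , q , eq = Reps-assign⁻ Θ A d as ns (subst (λ e → Reps e α) evalE-params r)
        in cs , ms , p , q , subst (B ⊨ φ [_]) eq (to (translate-correct Θ A d φ params {β₀} r) t))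
      (λ (cs , ms , p , q , t) →
        let r = subst (λ e → Reps e (assign {A = B} cs ms)) (sym evalE-params) (Reps-assign⁺ Θ A d p q)
        in (assign {A = B} cs ms , r) , from (translate-correct Θ A d φ params {β₀} r) t)

lemma6p6 : (τ₁ τ₂ : Vocabulary) (Θ : Transduction τ₁ τ₂) → 1 ≤ arity Θ →
    (κ lam : ℕ) (φ : Formula τ₂ (replicate κ str ++ nums lam)) →
    Σ[ ψ ∈ Formula τ₁ (copies κ (sorts Θ) ++ copies lam (nums (arity Θ))) ]
    ((A : Structure τ₁) (d : Defined Θ A)
    (as : Vec (A ^ sorts Θ) κ) (ns : Vec (A ^ nums (arity Θ)) lam) →
    A ⊨ ψ [ ++⁺ (flatten as) (flatten ns) ]
    ⇔
    (Σ[ cs ∈ Vec (V (transduce Θ A d)) κ ] Σ[ ms ∈ Vec (Dom (transduce Θ A d) num) lam ]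
    Pointwise (_/≈≡_ Θ A) as cs
    × Pointwise (λ n m → value A (arity Θ) n ≡ toℕ m) ns ms
    × transduce Θ A d ⊨ φ [ assign cs ms ]))
lemma6p6 τ₁ τ₂ Θ _ κ lam φ = pullback Θ κ lam φ , pullback-correct Θ κ lam φ
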